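{- For every odd positive integer $n$, $$\sigma_{3}(n)=12\sum_{\substack{i,j\ge 0\\ i+j=n}}\widehat{\sigma}(i)\,\widehat{\sigma}(j),\qquad \sigma_{5}(n)=192\sum_{\substack{i,j,k\ge 0\\ i+j+k=n}}\widehat{\sigma}(i)\,\widehat{\sigma}(j)\,\widehat{\sigma}(k),$$ where $\widehat{\sigma}(0)=\tfrac1{24}$.
   Context: For integers $n\ge1$, $\sigma_{s}(n)=\sum_{d\mid n}d^{s}$ and $\widehat{\sigma}(n)=\widehat{\sigma}_{1}(n)=\sum_{d\mid n}(-1)^{n/d-1}d$. The value $\widehat{\sigma}(0)$ is assigned as in the claim. -}

module Defs where

open import Data.Nat using (ℕ; zero; suc; _+_; _∸_; _^_; _/_; _≟_)
open import Data.Nat.ListAction using (sum)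
open import Data.Nat.Divisibility using (_∣?_)
open import Data.Integer as ℤ using (ℤ; +_; -1ℤ; 0ℤ)
open import Data.Rational as ℚ using (ℚ; 0ℚ)
open import Data.List using (List; map; filter; foldr; upTo; cartesianProduct)
open import Data.Product using (_×_; _,_)

-- The positive divisors d of n (for n ≥ 1), each encoded as d - 1, so that
-- division by d = suc e is available without a separate NonZero proof.
divisorPreds : ℕ → List ℕ
divisorPreds n = filter (λ e → suc e ∣? n) (upTo n)

σ : ℕ → ℕ → ℕ
σ s n = sum (map (λ e → suc e ^ s) (divisorPreds n))

sumℤ : List ℤ → ℤ
sumℤ = foldr ℤ._+_ 0ℤ

sumℚ : List ℚ → ℚ
sumℚ = foldr ℚ._+_ 0ℚ

-- For d ∣ n and n ≥ 1 we have n / d ≥ 1, so the truncated n / d ∸ 1 is the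
-- true difference.
σ̂⁺ : ℕ → ℤ
σ̂⁺ n = sumℤ (map (λ e → (-1ℤ ℤ.^ (n / suc e ∸ 1)) ℤ.* (+ suc e)) (divisorPreds n))

fromℤ : ℤ → ℚ
fromℤ z = z ℚ./ 1

σ̂ : ℕ → ℚ
σ̂ zero    = + 1 ℚ./ 24
σ̂ (suc m) = fromℤ (σ̂⁺ (suc m))

-- All (i , j) with i , j ≥ 0 and i + j ≡ n; such i , j are automatically ≤ n.
pairs : ℕ → List (ℕ × ℕ)
pairs n = filter (λ (i , j) → i + j ≟ n)
            (cartesianProduct (upTo (suc n)) (upTo (suc n)))

triples : ℕ → List (ℕ × ℕ × ℕ)
triples n = filter (λ (i , j , k) → i + j + k ≟ n)
              (cartesianProduct (upTo (suc n))
                (cartesianProduct (upTo (suc n)) (upTo (suc n))))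

{-# OPTIONS --safe #-}

-- For n ≥ 1, σ̂ n is the sum of the odd divisors of n, so the convolutions become
-- sums of a b or a b³ over the positive solutions of a x + b y = n with prescribed
-- parities.  The step a x + b y = a (x − y) + (a + b) y of the Euclidean algorithm
-- is a bijection between the solutions with y < x and those with a < b.  Cutting such
-- sums along a < b, b < a and along x < y, y < x and matching the pieces by this
-- bijection, everything cancels except the diagonal x = y, where (a + b) x = n and a
-- power sum over the b < a + b of fixed parity remains (Liouville's method).  The cubic
-- formula comes from the weights (a ± b)², the quintic one from b² (a ± b)².

module Submission where

open import Data.Nat as ℕ using (ℕ; zero; suc; _<_; _^_; z≤n; s≤s)
import Data.Nat.Properties as ℕ
open import Data.Nat.Divisibility using (_∣_)
open import Data.Nat.ListAction using (sum)
open import Data.List using (List; []; _∷_; map; _++_; filter; upTo; cartesianProduct)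
open import Data.Parity.Base as ℙ using (Parity; 0ℙ; 1ℙ)
import Data.Parity.Properties as ℙ
open import Data.Product using (_×_; _,_; proj₁; proj₂)
open import Data.Sum as Sum using (_⊎_; inj₁; inj₂)
open import Data.Empty using (⊥)
open import Function using (_∘_; id; mk⇔)
open import Relation.Nullary using (¬_; yes; no; contradiction)
open import Relation.Nullary.Decidable using (_×-dec_; map′)
open import Relation.Unary using (Decidable)
open import Relation.Binary.Definitions using (tri<; tri≈; tri>)
open import Relation.Binary.PropositionalEquality
  using (_≡_; _≢_; _≗_; refl; sym; trans; cong; cong₂; subst; module ≡-Reasoning)
open import Defs

-- Let E be the power series with coefficients 24 σ̂(n), so that its constant term is 1, and let E =
-- o + e be its parts in odd and even exponents. At odd exponents E² is 2 e o and E³ is o³ + 3 e² o,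
-- which leaves few parity patterns. The value 1/24 is forced in e o: Liouville's method evaluates
-- 24 ∑ a b not as ∑ d³ but as ∑ d³ - ∑ d, and the missing ∑ d is what the constant term 1
-- contributes. Here 24 = 4 · 6, with 4 from (a + b)² - (a - b)² = 4 a b and 6 from a sum of
-- squares. In the cube, o² and e o are first replaced by multiples of sums of d³, so that only
-- double sums of a b³ remain. They run over two parity classes of solutions. A Euclidean step
-- interchanges these classes, and E³ contains both sums with the same coefficient, so only their
-- total has to be evaluated. Sums are compared in ℕ, with every identity arranged additively; ℚ
-- enters at the end, through the factor 1/24.

module ℕ-Identities where

  open import Data.Nat
  open import Data.Nat.Properties
  open import Data.Nat.DivMod using (m*n/n≡m; m*[n/m]≡n)
  open import Data.Nat.Divisibility using (_∣?_; divides; ∣⇒≤)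
  open import Data.Nat.ListAction.Properties using (sum-++; sum-↭)
  open import Data.Nat.Tactic.RingSolver using (solve-∀)
  open import Data.List.Properties using (map-++; map-∘)
  open import Data.List.Membership.Propositional using (_∈_)
  open import Data.List.Membership.Propositional.Properties
  open import Data.List.Membership.Propositional.Properties.WithK using (unique∧set⇒bag)
  open import Data.List.Relation.Binary.BagAndSetEquality using (∼bag⇒↭)
  open import Data.List.Relation.Binary.Permutation.Propositional using (_↭_)
  open import Data.List.Relation.Binary.Permutation.Propositional.Properties using (map⁺)
  open import Data.List.Relation.Unary.All as All using ([]; _∷_)
  open import Data.List.Relation.Unary.Any using (here; there)
  open import Data.List.Relation.Unary.AllPairs using ([]; _∷_)
  open import Data.List.Relation.Unary.Unique.Propositional using (Unique)
  import Data.List.Relation.Unary.Unique.Propositional.Properties as Unique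
  open import Data.Parity.Properties using (+-homo-+; *-homo-*; suc-homo-⁻¹)

  -- Finite sums over enumerated predicates

  private
    variable
      A B : Set
      P Q R : A → Set

  -- The predicate determines the list up to permutation, hence every sum over it. Sums can then be
  -- compared by reasoning about predicates alone, whatever order the lists have.
  record Enum {A : Set} (P : A → Set) : Set where
    field
      list     : List A
      unique   : Unique list
      sound    : ∀ {a} → a ∈ list → P a
      complete : ∀ {a} → P a → a ∈ list

  open Enum

  ∑ : Enum {A} P → (A → ℕ) → ℕ
  ∑ X w = sum (map w (list X))

  map-unique : (f : A → B) {xs : List A} →
               (∀ {x y} → x ∈ xs → y ∈ xs → f x ≡ f y → x ≡ y) →
               Unique xs → Unique (map f xs)
  map-unique f inj [] = []
  map-unique f inj (x∉ ∷ u) =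
    All.tabulate (λ m eq → let z , z∈ , e = ∈-map⁻ f m in
      All.lookup x∉ z∈ (inj (here refl) (there z∈) (trans eq e)))
    ∷ map-unique f (λ p q → inj (there p) (there q)) u

  upto : ∀ n → Enum (_< n)
  upto n = record
    { list = upTo n ; unique = Unique.upTo⁺ n ; sound = ∈-upTo⁻ ; complete = ∈-upTo⁺ }

  relabel : (∀ {a} → P a → Q a) → (∀ {a} → Q a → P a) → Enum {A} P → Enum Q
  relabel P⇒Q Q⇒P X = record
    { list = list X ; unique = unique X
    ; sound = P⇒Q ∘ sound X ; complete = complete X ∘ Q⇒P }

  infixl 4 _∩_
  _∩_ : Enum {A} P → Decidable Q → Enum (λ a → P a × Q a)
  X ∩ Q? = record
    { list = filter Q? (list X)
    ; unique = Unique.filter⁺ Q? (unique X)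
    ; sound = λ m → let m′ , q = ∈-filter⁻ Q? m in sound X m′ , q
    ; complete = λ (p , q) → ∈-filter⁺ Q? (complete X p) q
    }

  disjointUnion : Enum {A} P → Enum Q → (∀ {a} → P a → Q a → ⊥) →
                  Enum (λ a → P a ⊎ Q a)
  disjointUnion X Y disj = record
    { list = list X ++ list Y
    ; unique = Unique.++⁺ (unique X) (unique Y) (λ (p , q) → disj (sound X p) (sound Y q))
    ; sound = λ m → Sum.map (sound X) (sound Y) (∈-++⁻ (list X) m)
    ; complete = λ { (inj₁ p) → ∈-++⁺ˡ (complete X p)
                   ; (inj₂ q) → ∈-++⁺ʳ (list X) (complete Y q) }
    }

  singleton : {A : Set} (a : A) → Enum (_≡ a)
  singleton a = record
    { list = a ∷ [] ; unique = [] ∷ []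
    ; sound = λ { (here refl) → refl } ; complete = λ { refl → here refl } }

  module _ {A B : Set} {P : A → Set} {R : A → B → Set} (Y : ∀ a → Enum (R a)) where

    fibres : List A → List (A × B)
    fibres []       = []
    fibres (a ∷ as) = map (a ,_) (list (Y a)) ++ fibres as

    ∈-fibres⁻ : ∀ xs {a b} → (a , b) ∈ fibres xs → a ∈ xs × R a b
    ∈-fibres⁻ (x ∷ xs) m with ∈-++⁻ (map (x ,_) (list (Y x))) m
    ... | inj₁ m₁ with b , b∈ , refl ← ∈-map⁻ (x ,_) m₁ = here refl , sound (Y x) b∈
    ... | inj₂ m₂ = let p , q = ∈-fibres⁻ xs m₂ in there p , q

    ∈-fibres⁺ : ∀ {xs a b} → a ∈ xs → R a b → (a , b) ∈ fibres xs
    ∈-fibres⁺ {xs = x ∷ xs} (here refl) r = ∈-++⁺ˡ (∈-map⁺ (x ,_) (complete (Y x) r))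
    ∈-fibres⁺ {xs = x ∷ xs} (there m)   r = ∈-++⁺ʳ (map (x ,_) (list (Y x))) (∈-fibres⁺ m r)

    fibres-unique : ∀ {xs} → Unique xs → Unique (fibres xs)
    fibres-unique [] = []
    fibres-unique {x ∷ xs} (x∉ ∷ u) =
      Unique.++⁺ (Unique.map⁺ (λ { refl → refl }) (unique (Y x))) (fibres-unique u)
        λ { (p , q) → let _ , _ , e = ∈-map⁻ (x ,_) p in
            All.lookup x∉ (proj₁ (∈-fibres⁻ xs q)) (sym (cong proj₁ e)) }

    fibration : Enum P → Enum (λ (a , b) → P a × R a b)
    fibration X = record
      { list = fibres (list X)
      ; unique = fibres-unique (unique X)
      ; sound = λ m → let p , r = ∈-fibres⁻ (list X) m in sound X p , r
      ; complete = λ (p , r) → ∈-fibres⁺ (complete X p) r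
      }

    ∑-fibration : (X : Enum P) (w : A × B → ℕ) →
                  ∑ (fibration X) w ≡ ∑ X (λ a → ∑ (Y a) (λ b → w (a , b)))
    ∑-fibration X w = go (list X)
      where
      go : ∀ xs → sum (map w (fibres xs)) ≡ sum (map (λ a → ∑ (Y a) (λ b → w (a , b))) xs)
      go [] = refl
      go (x ∷ xs) = begin
        sum (map w (map (x ,_) (list (Y x)) ++ fibres xs))
          ≡⟨ cong sum (map-++ w (map (x ,_) (list (Y x))) (fibres xs)) ⟩
        sum (map w (map (x ,_) (list (Y x))) ++ map w (fibres xs))
          ≡⟨ sum-++ (map w (map (x ,_) (list (Y x)))) _ ⟩
        sum (map w (map (x ,_) (list (Y x)))) + sum (map w (fibres xs))
          ≡⟨ cong₂ _+_ (cong sum (sym (map-∘ (list (Y x))))) (go xs) ⟩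
        ∑ (Y x) (λ b → w (x , b)) + sum (map (λ a → ∑ (Y a) (λ b → w (a , b))) xs) ∎
        where open ≡-Reasoning

  infixr 5 _⊗_
  _⊗_ : {A B : Set} {P : A → Set} {Q : B → Set} → Enum P → Enum Q → Enum (λ (a , b) → P a × Q b)
  X ⊗ Y = record
    { list = cartesianProduct (list X) (list Y)
    ; unique = Unique.cartesianProduct⁺ (unique X) (unique Y)
    ; sound = λ m → let p , q = ∈-cartesianProduct⁻ (list X) (list Y) m in sound X p , sound Y q
    ; complete = λ (p , q) → ∈-cartesianProduct⁺ (complete X p) (complete Y q)
    }

  -- The image of one list under `f` and the other list are both free of duplicates and have the
  -- same members, so they are permutations of each other. Every change of variables below is an
  -- instance; `f` and `g` need to be inverse only on the predicates.
  reindex : (X : Enum {A} P) (Y : Enum {B} Q) {w : A → ℕ} {v : B → ℕ} (f : A → B) (g : B → A) →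
            (∀ {a} → P a → Q (f a)) → (∀ {b} → Q b → P (g b)) →
            (∀ {a} → P a → g (f a) ≡ a) → (∀ {b} → Q b → f (g b) ≡ b) →
            (∀ {a} → P a → w a ≡ v (f a)) → ∑ X w ≡ ∑ Y v
  reindex {P = P} {Q = Q} X Y {w} {v} f g to from gf fg eq = begin
    sum (map w (list X))          ≡⟨ cong sum (map-cong-∈ (list X) (sound X)) ⟩
    sum (map (v ∘ f) (list X))    ≡⟨ cong sum (map-∘ (list X)) ⟩
    sum (map v (map f (list X)))  ≡⟨ sum-↭ (map⁺ v perm) ⟩
    sum (map v (list Y))          ∎
    where
    open ≡-Reasoning
    map-cong-∈ : ∀ xs → (∀ {a} → a ∈ xs → P a) → map w xs ≡ map (v ∘ f) xs
    map-cong-∈ [] s = refl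
    map-cong-∈ (x ∷ xs) s = cong₂ _∷_ (eq (s (here refl))) (map-cong-∈ xs (s ∘ there))
    inj : ∀ {x y} → x ∈ list X → y ∈ list X → f x ≡ f y → x ≡ y
    inj p q e = trans (sym (gf (sound X p))) (trans (cong g e) (gf (sound X q)))
    perm : map f (list X) ↭ list Y
    perm = ∼bag⇒↭ (unique∧set⇒bag (map-unique f inj (unique X)) (unique Y) (mk⇔
      (λ m → let a , a∈ , e = ∈-map⁻ f m in subst (_∈ list Y) (sym e) (complete Y (to (sound X a∈))))
      (λ m → subst (_∈ map f (list X)) (fg (sound Y m)) (∈-map⁺ f (complete X (from (sound Y m)))))))

  ∑-≡ : (X : Enum {A} P) (Y : Enum Q) {w v : A → ℕ} →
        (∀ {a} → P a → Q a) → (∀ {a} → Q a → P a) → (∀ {a} → P a → w a ≡ v a) →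
        ∑ X w ≡ ∑ Y v
  ∑-≡ X Y to from eq = reindex X Y id id to from (λ _ → refl) (λ _ → refl) eq

  ∑-cong : (X : Enum {A} P) {w v : A → ℕ} → (∀ {a} → P a → w a ≡ v a) → ∑ X w ≡ ∑ X v
  ∑-cong X = ∑-≡ X X id id

  sum-map-+ : (w v : A → ℕ) (xs : List A) →
              sum (map (λ a → w a + v a) xs) ≡ sum (map w xs) + sum (map v xs)
  sum-map-+ w v [] = refl
  sum-map-+ w v (x ∷ xs) rewrite sum-map-+ w v xs = interchange (w x) (v x) _ _
    where
    interchange : ∀ a b c d → (a + b) + (c + d) ≡ (a + c) + (b + d)
    interchange = solve-∀

  ∑-+ : (X : Enum {A} P) (w v : A → ℕ) → ∑ X (λ a → w a + v a) ≡ ∑ X w + ∑ X v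
  ∑-+ X w v = sum-map-+ w v (list X)

  sum-map-* : ∀ c (w : A → ℕ) (xs : List A) → sum (map (λ a → c * w a) xs) ≡ c * sum (map w xs)
  sum-map-* c w [] = sym (*-zeroʳ c)
  sum-map-* c w (x ∷ xs) rewrite sum-map-* c w xs = sym (*-distribˡ-+ c (w x) _)

  ∑-* : (X : Enum {A} P) (c : ℕ) (w : A → ℕ) → ∑ X (λ a → c * w a) ≡ c * ∑ X w
  ∑-* X c w = sum-map-* c w (list X)

  ∑-zero : (X : Enum {A} P) {w : A → ℕ} → (∀ {a} → P a → w a ≡ 0) → ∑ X w ≡ 0
  ∑-zero X {w} z = trans (∑-cong X z) (∑-* X 0 (λ _ → 0))

  ∑-⊎ : (X : Enum {A} P) (Y : Enum Q) (Z : Enum R) (w : A → ℕ) →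
        (∀ {a} → P a → Q a ⊎ R a) → (∀ {a} → Q a → P a) → (∀ {a} → R a → P a) →
        (∀ {a} → Q a → R a → ⊥) → ∑ X w ≡ ∑ Y w + ∑ Z w
  ∑-⊎ X Y Z w split l r disj = begin
    ∑ X w
      ≡⟨ ∑-≡ X (disjointUnion Y Z disj) split Sum.[ l , r ] (λ _ → refl) ⟩
    sum (map w (list Y ++ list Z))             ≡⟨ cong sum (map-++ w (list Y) (list Z)) ⟩
    sum (map w (list Y) ++ map w (list Z))     ≡⟨ sum-++ (map w (list Y)) _ ⟩
    ∑ Y w + ∑ Z w                            ∎
    where open ≡-Reasoning

  ∑-product : (X : Enum {A} P) (Y : Enum {B} Q) (w : A → ℕ) (v : B → ℕ) →
              ∑ (X ⊗ Y) (λ (a , b) → w a * v b) ≡ ∑ X w * ∑ Y v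
  ∑-product X Y w v = begin
    ∑ (X ⊗ Y) (λ (a , b) → w a * v b)
      ≡⟨ ∑-≡ (X ⊗ Y) (fibration (λ _ → Y) X) id id (λ _ → refl) ⟩
    ∑ (fibration (λ _ → Y) X) (λ (a , b) → w a * v b)
      ≡⟨ ∑-fibration (λ _ → Y) X _ ⟩
    ∑ X (λ a → ∑ Y (λ b → w a * v b))    ≡⟨ ∑-cong X (λ {a} _ → ∑-* Y (w a) v) ⟩
    ∑ X (λ a → w a * ∑ Y v)              ≡⟨ ∑-cong X (λ {a} _ → *-comm (w a) (∑ Y v)) ⟩
    ∑ X (λ a → ∑ Y v * w a)              ≡⟨ ∑-* X (∑ Y v) w ⟩
    ∑ Y v * ∑ X w                        ≡⟨ *-comm (∑ Y v) (∑ X w) ⟩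
    ∑ X w * ∑ Y v                        ∎
    where open ≡-Reasoning

  ∑-trichotomy : {A : Set} {P : A → Set} (X : Enum P) (f g : A → ℕ) (w : A → ℕ) →
                 ∑ X w ≡ ∑ (X ∩ (λ t → f t <? g t)) w +
                         (∑ (X ∩ (λ t → g t <? f t)) w + ∑ (X ∩ (λ t → f t ≟ g t)) w)
  ∑-trichotomy {P = P} X f g w = begin
    ∑ X w                    ≡⟨ ∑-⊎ X L (disjointUnion G E G∩E) w split proj₁ GE⇒P L∩GE ⟩
    ∑ L w + ∑ (disjointUnion G E G∩E) w
      ≡⟨ cong (∑ L w +_) (∑-⊎ (disjointUnion G E G∩E) G E w id inj₁ inj₂ G∩E) ⟩
    ∑ L w + (∑ G w + ∑ E w)  ∎
    where
    open ≡-Reasoning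
    L = X ∩ (λ t → f t <? g t)
    G = X ∩ (λ t → g t <? f t)
    E = X ∩ (λ t → f t ≟ g t)
    G∩E : ∀ {a} → P a × g a < f a → P a × f a ≡ g a → ⊥
    G∩E (_ , l) (_ , e) = <⇒≢ l (sym e)
    GE⇒P : ∀ {a} → (P a × g a < f a) ⊎ (P a × f a ≡ g a) → P a
    GE⇒P (inj₁ (p , _)) = p
    GE⇒P (inj₂ (p , _)) = p
    L∩GE : ∀ {a} → P a × f a < g a → (P a × g a < f a) ⊎ (P a × f a ≡ g a) → ⊥
    L∩GE (_ , l) (inj₁ (_ , l′)) = <-asym l l′
    L∩GE (_ , l) (inj₂ (_ , e))  = <⇒≢ l e
    split : ∀ {a} → P a → (P a × f a < g a) ⊎ ((P a × g a < f a) ⊎ (P a × f a ≡ g a))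
    split {a} p with <-cmp (f a) (g a)
    ... | tri< l _ _ = inj₁ (p , l)
    ... | tri≈ _ e _ = inj₂ (inj₂ (p , e))
    ... | tri> _ _ l = inj₂ (inj₁ (p , l))

  ∑-parity : ∀ {A : Set} {P : A → Set} (X : Enum P) (k : A → ℕ) (w : A → ℕ) →
             ∑ X w ≡ ∑ (X ∩ (λ t → parity (k t) ℙ.≟ 1ℙ)) w + ∑ (X ∩ (λ t → parity (k t) ℙ.≟ 0ℙ)) w
  ∑-parity {P = P} X k w = ∑-⊎ X (X ∩ (λ t → parity (k t) ℙ.≟ 1ℙ)) (X ∩ (λ t → parity (k t) ℙ.≟ 0ℙ)) w
    split proj₁ proj₁ (λ (_ , e₁) (_ , e₀) → contradiction (trans (sym e₀) e₁) λ ())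
    where
    split : ∀ {t} → P t → (P t × parity (k t) ≡ 1ℙ) ⊎ (P t × parity (k t) ≡ 0ℙ)
    split {t} p with parity (k t)
    ... | 1ℙ = inj₁ (p , refl)
    ... | 0ℙ = inj₂ (p , refl)

  -- Parity of natural numbers

  ℙ+-cancel : ∀ p q → (q ℙ.+ p) ℙ.+ p ≡ q
  ℙ+-cancel 0ℙ 0ℙ = refl
  ℙ+-cancel 0ℙ 1ℙ = refl
  ℙ+-cancel 1ℙ 0ℙ = refl
  ℙ+-cancel 1ℙ 1ℙ = refl

  parity-∸ : ∀ {m n} → n ≤ m → parity (m ∸ n) ≡ parity m ℙ.+ parity n
  parity-∸ {m} {n} n≤m = begin
    parity (m ∸ n)                            ≡⟨ ℙ+-cancel (parity n) _ ⟨
    (parity (m ∸ n) ℙ.+ parity n) ℙ.+ parity n ≡⟨ cong (ℙ._+ parity n) (+-homo-+ (m ∸ n) n) ⟨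
    parity (m ∸ n + n) ℙ.+ parity n           ≡⟨ cong (λ k → parity k ℙ.+ parity n) (m∸n+n≡m n≤m) ⟩
    parity m ℙ.+ parity n                     ∎
    where open ≡-Reasoning

  half+half : ∀ n → parity n ≡ 0ℙ → ⌊ n /2⌋ + ⌊ n /2⌋ ≡ n
  half+half zero          _ = refl
  half+half (suc (suc n)) p = cong suc (trans (+-suc ⌊ n /2⌋ ⌊ n /2⌋) (cong suc (half+half n p)))

  parity-n+n : ∀ n → parity (n + n) ≡ 0ℙ
  parity-n+n n = trans (+-homo-+ n n) (p+p (parity n))
    where
    p+p : ∀ p → p ℙ.+ p ≡ 0ℙ
    p+p 0ℙ = refl
    p+p 1ℙ = refl

  ¬2∣⇒odd : ∀ n → ¬ (2 ∣ n) → parity n ≡ 1ℙ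
  ¬2∣⇒odd n ¬2∣n with parity n in eq
  ... | 1ℙ = refl
  ... | 0ℙ = contradiction (divides ⌊ n /2⌋ (trans (sym (half+half n eq)) (lem ⌊ n /2⌋))) ¬2∣n
    where
    lem : ∀ h → h + h ≡ h * 2
    lem = solve-∀

  -- Factorizations d e = n and solutions of a x + b y = n

  Pair Quad : Set
  Pair = ℕ × ℕ
  Quad = ℕ × ℕ × ℕ × ℕ

  record Factors (n : ℕ) (t : Pair) : Set where
    constructor factors
    field
      pos : 0 < proj₁ t × 0 < proj₂ t
      eq  : proj₁ t * proj₂ t ≡ n

  -- The parities belong to a, b, x, y in this order. They are part of the predicate because a
  -- Euclidean step acts on them linearly modulo 2 and so carries whole parity classes to each
  -- other.
  record Sol (p q r s : Parity) (n : ℕ) (t : Quad) : Set where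
    constructor sol
    field
      pos : let (a , b , x , y) = t in (0 < a × 0 < b) × (0 < x × 0 < y)
      eq  : let (a , b , x , y) = t in a * x + b * y ≡ n
      par : let (a , b , x , y) = t in (parity a ≡ p × parity b ≡ q) × (parity x ≡ r × parity y ≡ s)

  factor≤ : ∀ {a x m} → 0 < x → a * x ≤ m → a ≤ m
  factor≤ {a} {x = suc x} _ = ≤-trans (m≤m*n a (suc x))

  factors? : ∀ n → Decidable (Factors n)
  factors? n (d , e) = map′ (λ (u , v) → factors u v) (λ (factors u v) → u , v)
    ((0 <? d ×-dec 0 <? e) ×-dec d * e ≟ n)

  sol? : ∀ p q r s n → Decidable (Sol p q r s n)
  sol? p q r s n (a , b , x , y) = map′
    (λ (u , v , w) → sol u v w) (λ (sol u v w) → u , v , w)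
    (((0 <? a ×-dec 0 <? b) ×-dec (0 <? x ×-dec 0 <? y)) ×-dec a * x + b * y ≟ n ×-dec
     ((parity a ℙ.≟ p ×-dec parity b ℙ.≟ q) ×-dec (parity x ℙ.≟ r ×-dec parity y ℙ.≟ s)))

  -- Unfolding these searches would make conversion checking slow.
  abstract
    factorizations : ∀ n → Enum (Factors n)
    factorizations n = relabel proj₂ (λ F → bounded F , F) (upto (suc n) ⊗ upto (suc n) ∩ factors? n)
      where
      bounded : ∀ {t} → Factors n t → proj₁ t < suc n × proj₂ t < suc n
      bounded {d , e} (factors (d>0 , e>0) refl) =
        s≤s (factor≤ e>0 ≤-refl) , s≤s (factor≤ d>0 (≤-reflexive (*-comm e d)))

    solutions : ∀ p q r s n → Enum (Sol p q r s n)
    solutions p q r s n = relabel proj₂ (λ S → bounded S , S)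
      (U ⊗ U ⊗ U ⊗ U ∩ sol? p q r s n)
      where
      U : Enum (_< suc n)
      U = upto (suc n)
      bounded : ∀ {t} → Sol p q r s n t → let (a , b , x , y) = t in
                a < suc n × b < suc n × x < suc n × y < suc n
      bounded {a , b , x , y} (sol ((a>0 , b>0) , (x>0 , y>0)) refl _) =
        s≤s (factor≤ x>0 l) , s≤s (factor≤ y>0 r′) ,
        s≤s (factor≤ a>0 (subst (_≤ a * x + b * y) (*-comm a x) l)) , s≤s (factor≤ b>0 (subst (_≤ a * x + b * y) (*-comm b y) r′))
        where
        l : a * x ≤ a * x + b * y
        l = m≤m+n _ _
        r′ : b * y ≤ a * x + b * y
        r′ = m≤n+m _ _

  HasParities : Parity → Parity → Pair → Set
  HasParities p q (d , e) = parity d ≡ p × parity e ≡ q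

  hasParities? : ∀ p q → Decidable (HasParities p q)
  hasParities? p q (d , e) = parity d ℙ.≟ p ×-dec parity e ℙ.≟ q

  -- `p` constrains the divisor and `q` its cofactor, so the sum is supported on n of parity
  -- `p ℙ.* q`.
  divisorSum : Parity → Parity → (ℕ → ℕ) → ℕ → ℕ
  divisorSum p q f n = ∑ (factorizations n ∩ hasParities? p q) (f ∘ proj₁)

  a<b b<a x<y y<x a≡b x≡y : Quad → Set
  a<b (a , b , x , y) = a < b
  b<a (a , b , x , y) = b < a
  x<y (a , b , x , y) = x < y
  y<x (a , b , x , y) = y < x
  a≡b (a , b , x , y) = a ≡ b
  x≡y (a , b , x , y) = x ≡ y

  a<b? : Decidable a<b
  a<b? (a , b , x , y) = a <? b
  b<a? : Decidable b<a
  b<a? (a , b , x , y) = b <? a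
  x<y? : Decidable x<y
  x<y? (a , b , x , y) = x <? y
  y<x? : Decidable y<x
  y<x? (a , b , x , y) = y <? x
  a≡b? : Decidable a≡b
  a≡b? (a , b , x , y) = a ≟ b
  x≡y? : Decidable x≡y
  x≡y? (a , b , x , y) = x ≟ y

  onCoeffs : (ℕ → ℕ → ℕ) → Quad → ℕ
  onCoeffs w (a , b , _) = w a b

  -- The mirror symmetry and the Euclidean steps

  module _ (n : ℕ) where

    mirror : ∀ p q r s {C D : Quad → Set} (C? : Decidable C) (D? : Decidable D)
             (w : ℕ → ℕ → ℕ) →
             (∀ {a b x y} → C (a , b , x , y) → D (b , a , y , x)) →
             (∀ {a b x y} → D (a , b , x , y) → C (b , a , y , x)) →
             ∑ (solutions p q r s n ∩ C?) (onCoeffs w) ≡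
             ∑ (solutions q p s r n ∩ D?) (onCoeffs (λ a b → w b a))
    mirror p q r s C? D? w C⇒D D⇒C =
      reindex (solutions p q r s n ∩ C?) (solutions q p s r n ∩ D?) swap swap
        (λ (S , c) → swapSol S , C⇒D c) (λ (S , d) → swapSol S , D⇒C d)
        (λ _ → refl) (λ _ → refl) (λ _ → refl)
      where
      swap : Quad → Quad
      swap (a , b , x , y) = b , a , y , x
      swapSol : ∀ {p q r s t} → Sol p q r s n t → Sol q p s r n (swap t)
      swapSol {t = a , b , x , y} (sol ((u , v) , (w , z)) eq ((e , f) , (g , h))) =
        sol ((v , u) , (z , w)) (trans (+-comm (b * y) (a * x)) eq) ((f , e) , (h , g))

    -- Since x - y and x + y have the same parity, the step acts on classes by (p, q, r, s) ↦ (p, p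
    -- + q, r + s, s), which is an involution. The weight `w` is that of the target, whose second
    -- coefficient is the old a + b.
    euclidʸ : ∀ p q r s (w : ℕ → ℕ → ℕ) →
              ∑ (solutions p q r s n ∩ y<x?) (onCoeffs (λ a b → w a (a + b))) ≡
              ∑ (solutions p (p ℙ.+ q) (r ℙ.+ s) s n ∩ a<b?) (onCoeffs w)
    euclidʸ p q r s w =
      reindex (solutions p q r s n ∩ y<x?) (solutions p (p ℙ.+ q) (r ℙ.+ s) s n ∩ a<b?)
        (λ (a , b , x , y) → a , a + b , x ∸ y , y)
        (λ (a , b , x , y) → a , b ∸ a , x + y , y)
        to from gf fg (λ _ → refl)
      where
      to : ∀ {t : Quad} → let (a , b , x , y) = t in Sol p q r s n t × y < x →
           Sol p (p ℙ.+ q) (r ℙ.+ s) s n (a , a + b , x ∸ y , y) × a < a + b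
      to {a , b , x , y} (sol ((a>0 , b>0) , (_ , y>0)) refl ((refl , refl) , (refl , refl)) , y<x) =
        sol ((a>0 , <-≤-trans a>0 (m≤m+n a b)) , (m<n⇒0<n∸m y<x , y>0)) eq
          ((refl , +-homo-+ a b) , (parity-∸ (<⇒≤ y<x) , refl))
        , m<m+n a b>0
        where
        eq : a * (x ∸ y) + (a + b) * y ≡ a * x + b * y
        eq = trans (lem a b (x ∸ y) y) (cong (λ z → a * z + b * y) (m∸n+n≡m (<⇒≤ y<x)))
          where
          lem : ∀ a b x y → a * x + (a + b) * y ≡ a * (x + y) + b * y
          lem = solve-∀
      from : ∀ {t : Quad} → let (a , b , x , y) = t in Sol p (p ℙ.+ q) (r ℙ.+ s) s n t × a < b →
             Sol p q r s n (a , b ∸ a , x + y , y) × y < x + y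
      from {a , b , x , y} (sol ((a>0 , _) , (x>0 , y>0)) refl ((refl , pb) , (px , refl)) , a<b) =
        sol ((a>0 , m<n⇒0<n∸m a<b) , (<-≤-trans x>0 (m≤m+n x y) , y>0)) eq
          ((refl , trans (parity-∸ (<⇒≤ a<b)) (trans (cong (ℙ._+ parity a) (trans pb (ℙ.+-comm (parity a) q))) (ℙ+-cancel (parity a) q)))
          , (trans (+-homo-+ x y) (trans (cong (ℙ._+ parity y) px) (ℙ+-cancel (parity y) r)) , refl))
        , m<n+m y x>0
        where
        eq : a * (x + y) + (b ∸ a) * y ≡ a * x + b * y
        eq = trans (lem a (b ∸ a) x y) (cong (λ z → a * x + z * y) (m+[n∸m]≡n (<⇒≤ a<b)))
          where
          lem : ∀ a b x y → a * (x + y) + b * y ≡ a * x + (a + b) * y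
          lem = solve-∀
      gf : ∀ {t : Quad} → let (a , b , x , y) = t in Sol p q r s n t × y < x →
           (a , a + b ∸ a , x ∸ y + y , y) ≡ t
      gf {a , b , x , y} (_ , y<x) = cong₂ (λ b x → a , b , x , y) (m+n∸m≡n a b) (m∸n+n≡m (<⇒≤ y<x))
      fg : ∀ {t : Quad} → let (a , b , x , y) = t in Sol p (p ℙ.+ q) (r ℙ.+ s) s n t × a < b →
           (a , a + (b ∸ a) , x + y ∸ y , y) ≡ t
      fg {a , b , x , y} (_ , a<b) = cong₂ (λ b x → a , b , x , y) (m+[n∸m]≡n (<⇒≤ a<b)) (m+n∸n≡m x y)

    -- This is `euclidʸ` conjugated by `mirror`: now b and x stay fixed, and the class changes by
    -- (p, q, r, s) ↦ (p + q, q, r, r + s).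
    euclidˣ : ∀ p q r s (w : ℕ → ℕ → ℕ) →
              ∑ (solutions p q r s n ∩ x<y?) (onCoeffs (λ a b → w (a + b) b)) ≡
              ∑ (solutions (p ℙ.+ q) q r (r ℙ.+ s) n ∩ b<a?) (onCoeffs w)
    euclidˣ p q r s w = begin
      ∑ (solutions p q r s n ∩ x<y?) (onCoeffs (λ a b → w (a + b) b))
        ≡⟨ mirror p q r s x<y? y<x? _ id id ⟩
      ∑ (solutions q p s r n ∩ y<x?) (onCoeffs (λ a b → w (b + a) a))
        ≡⟨ ∑-cong (solutions q p s r n ∩ y<x?) (λ {(a , b , _)} _ → cong (λ c → w c a) (+-comm b a)) ⟩
      ∑ (solutions q p s r n ∩ y<x?) (onCoeffs (λ a b → w (a + b) a))
        ≡⟨ euclidʸ q p s r (λ a b → w b a) ⟩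
      ∑ (solutions q (q ℙ.+ p) (s ℙ.+ r) r n ∩ a<b?) (onCoeffs (λ a b → w b a))
        ≡⟨ mirror q (q ℙ.+ p) (s ℙ.+ r) r a<b? b<a? _ id id ⟩
      ∑ (solutions (q ℙ.+ p) q r (s ℙ.+ r) n ∩ b<a?) (onCoeffs w)
        ≡⟨ cong₂ (λ u v → ∑ (solutions u q r v n ∩ b<a?) (onCoeffs w)) (ℙ.+-comm q p) (ℙ.+-comm s r) ⟩
      ∑ (solutions (p ℙ.+ q) q r (r ℙ.+ s) n ∩ b<a?) (onCoeffs w) ∎
      where open ≡-Reasoning

  square-* : ∀ a b → (a * b) ^ 2 ≡ a ^ 2 * b ^ 2
  square-* = lem
    where
    -- Powers are spelled out in the form to which `_^ 2` unfolds, so that the solver meets sums and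
    -- products only; later auxiliary identities do the same.
    lem : ∀ a b → (a * b) * ((a * b) * 1) ≡ a * (a * 1) * (b * (b * 1))
    lem = solve-∀

  -- The identity (a + b)² - (a - b)² = 4 a b in additive form. It turns Liouville's identity for
  -- squares into an evaluation of ∑ a b.
  square-∣-∣ : ∀ a b → (a + b) ^ 2 ≡ ∣ a - b ∣ ^ 2 + 4 * (a * b)
  square-∣-∣ a b with ≤-total a b
  ... | inj₁ a≤b with c , refl ← m≤n⇒∃[o]m+o≡n a≤b rewrite ∣m-m+n∣≡n a c = lem a c
    where
    lem : ∀ a c → (a + (a + c)) * ((a + (a + c)) * 1) ≡ c * (c * 1) + 4 * (a * (a + c))
    lem = solve-∀
  ... | inj₂ b≤a with c , refl ← m≤n⇒∃[o]m+o≡n b≤a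
    rewrite ∣-∣-comm (b + c) b | ∣m-m+n∣≡n b c = lem b c
    where
    lem : ∀ b c → (b + c + b) * ((b + c + b) * 1) ≡ c * (c * 1) + 4 * ((b + c) * b)
    lem = solve-∀

  -- Liouville's identities

  module Solutions (n : ℕ) where

    S : ∀ p q r s → Enum (Sol p q r s n)
    S p q r s = solutions p q r s n

    split-ab : ∀ p q r s (w : ℕ → ℕ → ℕ) → (∀ {a b} → a ≡ b → parity a ≡ p → parity b ≡ q → w a b ≡ 0) →
               ∑ (S p q r s) (onCoeffs w) ≡
               ∑ (S p q r s ∩ a<b?) (onCoeffs w) + ∑ (S p q r s ∩ b<a?) (onCoeffs w)
    split-ab p q r s w z = begin
      ∑ X v                                                ≡⟨ ∑-trichotomy X proj₁ (proj₁ ∘ proj₂) v ⟩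
      ∑ (X ∩ a<b?) v + (∑ (X ∩ b<a?) v + ∑ (X ∩ a≡b?) v)
        ≡⟨ cong (λ k → ∑ (X ∩ a<b?) v + (∑ (X ∩ b<a?) v + k))
                (∑-zero (X ∩ a≡b?) (λ (P , e) → let (pa , pb) , _ = Sol.par P in z e pa pb)) ⟩
      ∑ (X ∩ a<b?) v + (∑ (X ∩ b<a?) v + 0)                ≡⟨ cong (∑ (X ∩ a<b?) v +_) (+-identityʳ _) ⟩
      ∑ (X ∩ a<b?) v + ∑ (X ∩ b<a?) v                      ∎
      where
      open ≡-Reasoning
      X = S p q r s
      v = onCoeffs w

    split-ab-≢ : ∀ p q r s (w : ℕ → ℕ → ℕ) → p ≢ q →
                 ∑ (S p q r s) (onCoeffs w) ≡
                 ∑ (S p q r s ∩ a<b?) (onCoeffs w) + ∑ (S p q r s ∩ b<a?) (onCoeffs w)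
    split-ab-≢ p q r s w p≢q =
      split-ab p q r s w (λ { refl refl pb → contradiction pb p≢q })

    split-xy : ∀ p q r s (w : ℕ → ℕ → ℕ) →
               ∑ (S p q r s) (onCoeffs w) ≡
               ∑ (S p q r s ∩ x<y?) (onCoeffs w) +
               (∑ (S p q r s ∩ y<x?) (onCoeffs w) + ∑ (S p q r s ∩ x≡y?) (onCoeffs w))
    split-xy p q r s w =
      ∑-trichotomy (S p q r s) (proj₁ ∘ proj₂ ∘ proj₂) (proj₂ ∘ proj₂ ∘ proj₂) (onCoeffs w)

    split-xy-≢ : ∀ p q r s (w : ℕ → ℕ → ℕ) → r ≢ s →
                 ∑ (S p q r s) (onCoeffs w) ≡
                 ∑ (S p q r s ∩ x<y?) (onCoeffs w) + ∑ (S p q r s ∩ y<x?) (onCoeffs w)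
    split-xy-≢ p q r s w r≢s = begin
      ∑ X v                                                ≡⟨ split-xy p q r s w ⟩
      ∑ (X ∩ x<y?) v + (∑ (X ∩ y<x?) v + ∑ (X ∩ x≡y?) v)
        ≡⟨ cong (λ k → ∑ (X ∩ x<y?) v + (∑ (X ∩ y<x?) v + k))
                (∑-zero (X ∩ x≡y?) (λ { (sol _ _ (_ , (refl , py)) , refl) → contradiction py r≢s })) ⟩
      ∑ (X ∩ x<y?) v + (∑ (X ∩ y<x?) v + 0)                ≡⟨ cong (∑ (X ∩ x<y?) v +_) (+-identityʳ _) ⟩
      ∑ (X ∩ x<y?) v + ∑ (X ∩ y<x?) v                      ∎
      where
      open ≡-Reasoning
      X = S p q r s
      v = onCoeffs w

    -- The new coefficients are a and a + b, and the old b is their distance. So a weight in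
    -- `∣ a - b ∣` on the piece a < b can be traced back to the piece y < x.
    euclidʸ-∣-∣ : ∀ p q r s (w : ℕ → ℕ → ℕ) →
                  ∑ (S p q r s ∩ y<x?) (onCoeffs (λ a b → w b (a + b))) ≡
                  ∑ (S p (p ℙ.+ q) (r ℙ.+ s) s ∩ a<b?) (onCoeffs (λ a b → w ∣ a - b ∣ b))
    euclidʸ-∣-∣ p q r s w = trans
      (∑-cong (S p q r s ∩ y<x?) (λ {(a , b , _)} _ → cong (λ c → w c (a + b)) (sym (∣m-m+n∣≡n a b))))
      (euclidʸ n p q r s (λ a b → w ∣ a - b ∣ b))

    euclidˣ-∣-∣ : ∀ p q r s (w : ℕ → ℕ → ℕ) →
                  ∑ (S p q r s ∩ x<y?) (onCoeffs (λ a b → w a b)) ≡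
                  ∑ (S (p ℙ.+ q) q r (r ℙ.+ s) ∩ b<a?) (onCoeffs (λ a b → w ∣ a - b ∣ b))
    euclidˣ-∣-∣ p q r s w = trans
      (∑-cong (S p q r s ∩ x<y?) (λ {(a , b , _)} _ → cong (λ c → w c b) (sym (∣m+n-n∣≡m a b))))
      (euclidˣ n p q r s (λ a b → w ∣ a - b ∣ b))
      where
      ∣m+n-n∣≡m : ∀ m n → ∣ m + n - n ∣ ≡ m
      ∣m+n-n∣≡m m n = trans (∣-∣-comm (m + n) n) (trans (cong (∣ n -_∣) (+-comm m n)) (∣m-m+n∣≡n n m))

    module _ (h : ℕ → ℕ) (h0≡0 : h 0 ≡ 0) where

      hb h+ h∣-∣ : ℕ → ℕ → ℕ
      hb   a b = h b
      h+   a b = h (a + b)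
      h∣-∣ a b = h ∣ a - b ∣

      -- The line a = b is reached by no Euclidean step; `h 0 ≡ 0` removes it from the sums of h ∣ a
      -- - b ∣.
      h∣-∣-diagonal : ∀ {p q : Parity} {a b} → a ≡ b → parity a ≡ p → parity b ≡ q → h∣-∣ a b ≡ 0
      h∣-∣-diagonal {a = a} refl _ _ = trans (cong h (∣n-n∣≡0 a)) h0≡0

      -- Let N and K be the classes (1, 0, 1, 1) and (1, 0, 1, 0) with weight h b. The pieces of the
      -- sum of h (a + b) are the pieces a < b of K and N, those of h ∣ a - b ∣ the pieces y < x of
      -- N and K. The two cuts of N and of K relate these; their other pieces are exchanged by the
      -- step `euclidˣ`, and the diagonal x = y of N is left over.
      liouville-odd : ∑ (S 1ℙ 1ℙ 0ℙ 1ℙ) (onCoeffs h+) ≡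
                      ∑ (S 1ℙ 1ℙ 0ℙ 1ℙ) (onCoeffs h∣-∣) + ∑ (S 1ℙ 0ℙ 1ℙ 1ℙ ∩ x≡y?) (onCoeffs hb)
      liouville-odd = combine
        (trans (split-xy-≢ 1ℙ 1ℙ 0ℙ 1ℙ h+ λ ()) (cong₂ _+_
          (trans (euclidˣ n 1ℙ 1ℙ 0ℙ 1ℙ (λ a _ → h a)) (mirror n 0ℙ 1ℙ 0ℙ 1ℙ b<a? a<b? (λ a _ → h a) id id))
          (euclidʸ n 1ℙ 1ℙ 0ℙ 1ℙ hb)))
        (trans (split-ab 1ℙ 1ℙ 0ℙ 1ℙ h∣-∣ h∣-∣-diagonal) (cong₂ _+_
          (sym (euclidʸ-∣-∣ 1ℙ 0ℙ 1ℙ 1ℙ (λ c _ → h c)))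
          (trans (sym (euclidˣ-∣-∣ 0ℙ 1ℙ 0ℙ 1ℙ (λ c _ → h c)))
                 (mirror n 0ℙ 1ℙ 0ℙ 1ℙ x<y? y<x? (λ a _ → h a) id id))))
        (trans (sym (split-ab-≢ 1ℙ 0ℙ 1ℙ 1ℙ hb λ ())) (split-xy 1ℙ 0ℙ 1ℙ 1ℙ hb))
        (trans (sym (split-ab-≢ 1ℙ 0ℙ 1ℙ 0ℙ hb λ ())) (split-xy-≢ 1ℙ 0ℙ 1ℙ 0ℙ hb λ ()))
        (euclidˣ n 1ℙ 0ℙ 1ℙ 1ℙ hb)
        (euclidˣ n 1ℙ 0ℙ 1ℙ 0ℙ hb)
        where
        -- The letter stands for the class and the suffix for the piece: `a` for a < b, `b` for b <
        -- a, `x` for x < y, `y` for y < x; `D` is the diagonal x = y.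
        combine : ∀ {M+ M- D Nx Ny Na Nb Kx Ky Ka Kb : ℕ} →
                  M+ ≡ Ka + Na → M- ≡ Ny + Ky →
                  Na + Nb ≡ Nx + (Ny + D) → Ka + Kb ≡ Kx + Ky → Nx ≡ Kb → Kx ≡ Nb →
                  M+ ≡ M- + D
        combine {D = D} {Nx} {Ny} {Na} {Nb} {Kx} {Ky} {Ka} {Kb} refl refl eN eK refl refl =
          -- As `Nx` is `Kb` and `Kx` is `Nb`, adding them to both sides completes the full sums
          -- over N and K.
          +-cancelʳ-≡ (Nx + Kx) (Ka + Na) (Ny + Ky + D) (begin
            Ka + Na + (Nx + Kx)         ≡⟨ lem₁ Ka Na Nx Kx ⟩
            (Na + Kx) + (Ka + Nx)       ≡⟨ cong₂ _+_ eN eK ⟩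
            Nx + (Ny + D) + (Kx + Ky)   ≡⟨ lem₂ Nx Ny D Kx Ky ⟩
            Ny + Ky + D + (Nx + Kx)     ∎)
          where
          open ≡-Reasoning
          lem₁ : ∀ a b c d → a + b + (c + d) ≡ (b + d) + (a + c)
          lem₁ = solve-∀
          lem₂ : ∀ a b c d e → a + (b + c) + (d + e) ≡ b + e + c + (a + d)
          lem₂ = solve-∀

      -- The step `euclidˣ` maps the class (1, 0, 0, 1) to itself, so its pieces x < y and b < a
      -- agree, and hence also y < x and a < b. Off the diagonal, each side is twice one of the
      -- latter two.
      liouville-even : ∑ (S 1ℙ 1ℙ 1ℙ 1ℙ) (onCoeffs h+) ≡
                       ∑ (S 1ℙ 1ℙ 1ℙ 1ℙ) (onCoeffs h∣-∣) + ∑ (S 1ℙ 1ℙ 1ℙ 1ℙ ∩ x≡y?) (onCoeffs h+)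
      liouville-even = combine
        (split-xy 1ℙ 1ℙ 1ℙ 1ℙ h+)
        (trans (euclidˣ n 1ℙ 1ℙ 1ℙ 1ℙ (λ a _ → h a)) (mirror n 0ℙ 1ℙ 1ℙ 0ℙ b<a? a<b? (λ a _ → h a) id id))
        (euclidʸ n 1ℙ 1ℙ 1ℙ 1ℙ hb)
        (trans (split-ab 1ℙ 1ℙ 1ℙ 1ℙ h∣-∣ h∣-∣-diagonal) (cong₂ _+_
          (sym (euclidʸ-∣-∣ 1ℙ 0ℙ 0ℙ 1ℙ (λ c _ → h c)))
          (trans (sym (euclidˣ-∣-∣ 0ℙ 1ℙ 1ℙ 0ℙ (λ c _ → h c)))
                 (mirror n 0ℙ 1ℙ 1ℙ 0ℙ x<y? y<x? (λ a _ → h a) id id))))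
        (trans (sym (split-ab-≢ 1ℙ 0ℙ 0ℙ 1ℙ hb λ ())) (split-xy-≢ 1ℙ 0ℙ 0ℙ 1ℙ hb λ ()))
        (euclidˣ n 1ℙ 0ℙ 0ℙ 1ℙ hb)
        where
        combine : ∀ {I+ Ix Iy I- D Jx Jy Ja Jb : ℕ} →
                  I+ ≡ Ix + (Iy + D) → Ix ≡ Ja → Iy ≡ Ja → I- ≡ Jy + Jy →
                  Ja + Jb ≡ Jx + Jy → Jx ≡ Jb → I+ ≡ I- + D
        combine {D = D} {Jx} {Jy} {Ja} refl refl refl refl eJ refl =
          trans (sym (+-assoc Ja Ja D)) (cong (λ k → k + k + D)
            (+-cancelʳ-≡ Jx Ja Jy (trans eJ (+-comm Jx Jy))))

    -- w+ − w∣-∣ = 4 a b³.  Under a Euclid step w+ becomes w∣-∣ on the piece y < x and wab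
    -- on the piece x < y; the wab terms add up to complete sums, which cancel by symmetry.
    private
      w+ w∣-∣ wab : ℕ → ℕ → ℕ
      w+   a b = (b * (a + b)) ^ 2
      w∣-∣ a b = (∣ a - b ∣ * b) ^ 2
      wab  a b = (a * b) ^ 2

      w∣-∣-diagonal : ∀ {p q : Parity} {a b} → a ≡ b → parity a ≡ p → parity b ≡ q → w∣-∣ a b ≡ 0
      w∣-∣-diagonal {a = a} refl _ _ = cong (λ k → (k * a) ^ 2) (∣n-n∣≡0 a)

    -- The step `euclidʸ` interchanges the classes (1, 1, 0, 1) and (1, 0, 1, 1), so the `w∣-∣`
    -- pieces match only after both are added. The `wab` pieces on the left make up the cut of (1,
    -- 0, 1, 0) by a and b, those on the right its cut by x and y. Only the second class, with x and
    -- y both odd, has a diagonal.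
    cubic : ∑ (S 1ℙ 1ℙ 0ℙ 1ℙ) (onCoeffs w+) + ∑ (S 1ℙ 0ℙ 1ℙ 1ℙ) (onCoeffs w+) ≡
            ∑ (S 1ℙ 1ℙ 0ℙ 1ℙ) (onCoeffs w∣-∣) + ∑ (S 1ℙ 0ℙ 1ℙ 1ℙ) (onCoeffs w∣-∣) +
            ∑ (S 1ℙ 0ℙ 1ℙ 1ℙ ∩ x≡y?) (onCoeffs w+)
    cubic = combine
      {Ma = ∑ (S 1ℙ 1ℙ 0ℙ 1ℙ ∩ a<b?) (onCoeffs w∣-∣)} {Na = ∑ (S 1ℙ 0ℙ 1ℙ 1ℙ ∩ a<b?) (onCoeffs w∣-∣)}
      {Kx = ∑ (K ∩ x<y?) (onCoeffs wab)} {Ky = ∑ (K ∩ y<x?) (onCoeffs wab)}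
      {Ka = ∑ (K ∩ a<b?) (onCoeffs wab)} {Kb = ∑ (K ∩ b<a?) (onCoeffs wab)}
      (trans (split-xy-≢ 1ℙ 1ℙ 0ℙ 1ℙ w+ λ ()) (cong₂ _+_
        (trans (to-wab 1ℙ 1ℙ 0ℙ 1ℙ) (mirror-wab 0ℙ 1ℙ 0ℙ 1ℙ b<a? a<b? id id))
        (euclidʸ-∣-∣ 1ℙ 1ℙ 0ℙ 1ℙ (λ c b → (c * b) ^ 2))))
      (trans (split-xy 1ℙ 0ℙ 1ℙ 1ℙ w+) (cong₂ _+_ (to-wab 1ℙ 0ℙ 1ℙ 1ℙ)
        (cong₂ _+_ (euclidʸ-∣-∣ 1ℙ 0ℙ 1ℙ 1ℙ (λ c b → (c * b) ^ 2)) refl)))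
      (trans (split-ab 1ℙ 1ℙ 0ℙ 1ℙ w∣-∣ w∣-∣-diagonal) (cong₂ _+_ refl
        (trans (sym (euclidˣ-∣-∣ 0ℙ 1ℙ 0ℙ 1ℙ wab)) (mirror-wab 0ℙ 1ℙ 0ℙ 1ℙ x<y? y<x? id id))))
      (trans (split-ab-≢ 1ℙ 0ℙ 1ℙ 1ℙ w∣-∣ λ ()) (cong₂ _+_ refl (sym (euclidˣ-∣-∣ 1ℙ 0ℙ 1ℙ 0ℙ wab))))
      (trans (sym (split-ab-≢ 1ℙ 0ℙ 1ℙ 0ℙ wab λ ())) (split-xy-≢ 1ℙ 0ℙ 1ℙ 0ℙ wab λ ()))
      where
      K = S 1ℙ 0ℙ 1ℙ 0ℙ
      to-wab : ∀ p q r s → ∑ (S p q r s ∩ x<y?) (onCoeffs w+) ≡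
                           ∑ (S (p ℙ.+ q) q r (r ℙ.+ s) ∩ b<a?) (onCoeffs wab)
      to-wab p q r s = trans
        (∑-cong (S p q r s ∩ x<y?) (λ {(a , b , _)} _ → cong (_^ 2) (*-comm b (a + b))))
        (euclidˣ n p q r s wab)
      mirror-wab : ∀ p q r s {C D : Quad → Set} (C? : Decidable C) (D? : Decidable D) →
        (∀ {a b x y} → C (a , b , x , y) → D (b , a , y , x)) →
        (∀ {a b x y} → D (a , b , x , y) → C (b , a , y , x)) →
        ∑ (S p q r s ∩ C?) (onCoeffs wab) ≡ ∑ (S q p s r ∩ D?) (onCoeffs wab)
      mirror-wab p q r s C? D? f g = trans (mirror n p q r s C? D? wab f g)
        (∑-cong (S q p s r ∩ D?) (λ {(a , b , _)} _ → cong (_^ 2) (*-comm b a)))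
      combine : ∀ {M+ N+ M- N- D Ma Na Kx Ky Ka Kb : ℕ} →
                M+ ≡ Ka + Na → N+ ≡ Kb + (Ma + D) → M- ≡ Ma + Ky → N- ≡ Na + Kx →
                Ka + Kb ≡ Kx + Ky → M+ + N+ ≡ M- + N- + D
      combine {D = D} {Ma} {Na} {Kx} {Ky} {Ka} {Kb} refl refl refl refl eK = begin
        Ka + Na + (Kb + (Ma + D))   ≡⟨ lem₁ Ka Na Kb Ma D ⟩
        (Ka + Kb) + (Ma + Na + D)   ≡⟨ cong (_+ (Ma + Na + D)) eK ⟩
        (Kx + Ky) + (Ma + Na + D)   ≡⟨ lem₂ Kx Ky Ma Na D ⟩
        Ma + Ky + (Na + Kx) + D     ∎
        where
        open ≡-Reasoning
        lem₁ : ∀ a b c d e → a + b + (c + (d + e)) ≡ (a + c) + (d + b + e)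
        lem₁ = solve-∀
        lem₂ : ∀ a b c d e → (a + b) + (c + d + e) ≡ c + b + (d + a) + e
        lem₂ = solve-∀

    ∑-difference : ∀ {P} (X : Enum P) (u v w : ℕ → ℕ → ℕ) → (∀ a b → u a b ≡ v a b + 4 * w a b) →
                   ∑ X (onCoeffs u) ≡ ∑ X (onCoeffs v) + 4 * ∑ X (onCoeffs w)
    ∑-difference X u v w eq = begin
      ∑ X (onCoeffs u)                                      ≡⟨ ∑-cong X (λ {(a , b , _)} _ → eq a b) ⟩
      ∑ X (λ t → onCoeffs v t + 4 * onCoeffs w t)           ≡⟨ ∑-+ X (onCoeffs v) _ ⟩
      ∑ X (onCoeffs v) + ∑ X (λ t → 4 * onCoeffs w t)       ≡⟨ cong (∑ X (onCoeffs v) +_) (∑-* X 4 (onCoeffs w)) ⟩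
      ∑ X (onCoeffs v) + 4 * ∑ X (onCoeffs w)               ∎
      where open ≡-Reasoning

    4∑ab-odd : 4 * ∑ (S 1ℙ 1ℙ 0ℙ 1ℙ) (onCoeffs _*_) ≡ ∑ (S 1ℙ 0ℙ 1ℙ 1ℙ ∩ x≡y?) (onCoeffs (λ a b → b ^ 2))
    4∑ab-odd = +-cancelˡ-≡ _ _ _
      (trans (sym (∑-difference (S 1ℙ 1ℙ 0ℙ 1ℙ) _ _ _*_ square-∣-∣)) (liouville-odd (_^ 2) refl))

    4∑ab-even : 4 * ∑ (S 1ℙ 1ℙ 1ℙ 1ℙ) (onCoeffs _*_) ≡
                ∑ (S 1ℙ 1ℙ 1ℙ 1ℙ ∩ x≡y?) (onCoeffs (λ a b → (a + b) ^ 2))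
    4∑ab-even = +-cancelˡ-≡ _ _ _
      (trans (sym (∑-difference (S 1ℙ 1ℙ 1ℙ 1ℙ) _ _ _*_ square-∣-∣)) (liouville-even (_^ 2) refl))

    4∑ab³ : 4 * (∑ (S 1ℙ 1ℙ 0ℙ 1ℙ) (onCoeffs (λ a b → a * b ^ 3)) + ∑ (S 1ℙ 0ℙ 1ℙ 1ℙ) (onCoeffs (λ a b → a * b ^ 3))) ≡
            ∑ (S 1ℙ 0ℙ 1ℙ 1ℙ ∩ x≡y?) (onCoeffs (λ a b → (b * (a + b)) ^ 2))
    4∑ab³ = +-cancelˡ-≡ _ _ _ (trans (sym expand) cubic)
      where
      open ≡-Reasoning
      diff : ∀ a b → w+ a b ≡ w∣-∣ a b + 4 * (a * b ^ 3)
      diff a b = begin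
        (b * (a + b)) ^ 2                          ≡⟨ square-* b (a + b) ⟩
        b ^ 2 * (a + b) ^ 2                        ≡⟨ cong (b ^ 2 *_) (square-∣-∣ a b) ⟩
        b ^ 2 * (∣ a - b ∣ ^ 2 + 4 * (a * b))      ≡⟨ lem ∣ a - b ∣ a b ⟩
        (∣ a - b ∣ * b) ^ 2 + 4 * (a * b ^ 3)      ∎
        where
        lem : ∀ d a b → b * (b * 1) * (d * (d * 1) + 4 * (a * b)) ≡
                         (d * b) * ((d * b) * 1) + 4 * (a * (b * (b * (b * 1))))
        lem = solve-∀
      ab³ : ℕ → ℕ → ℕ
      ab³ a b = a * b ^ 3
      U : ∀ {P} → Enum P → ℕ
      U X = ∑ X (onCoeffs ab³)
      M = S 1ℙ 1ℙ 0ℙ 1ℙ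
      N = S 1ℙ 0ℙ 1ℙ 1ℙ
      expand : ∑ M (onCoeffs w+) + ∑ N (onCoeffs w+) ≡
               (∑ M (onCoeffs w∣-∣) + ∑ N (onCoeffs w∣-∣)) + 4 * (U M + U N)
      expand = trans (cong₂ _+_ (∑-difference M w+ w∣-∣ ab³ diff) (∑-difference N w+ w∣-∣ ab³ diff))
                     (lem (∑ M (onCoeffs w∣-∣)) (∑ N (onCoeffs w∣-∣)) (U M) (U N))
        where
        lem : ∀ a b c d → (a + 4 * c) + (b + 4 * d) ≡ (a + b) + 4 * (c + d)
        lem = solve-∀

  -- Power sums over a residue class and the diagonal x = y

  Below : Parity → ℕ → ℕ → Set
  Below q d b = b < d × (0 < b × parity b ≡ q)

  below : ∀ q d → Enum (Below q d)
  below q d = upto d ∩ (λ b → 0 <? b ×-dec parity b ℙ.≟ q)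

  -- Raising the bound by 2 admits the candidates d and d + 1, and only d + 1 has parity `q`.
  ∑-below-2+ : ∀ q d (f : ℕ → ℕ) → parity (suc d) ≡ q →
               ∑ (below q (2 + d)) f ≡ ∑ (below q d) f + f (suc d)
  ∑-below-2+ q d f pd = begin
    ∑ (below q (2 + d)) f
      ≡⟨ ∑-⊎ (below q (2 + d)) (below q d) (singleton (suc d)) f split
           (λ (l , r) → m≤n⇒m≤1+n (m≤n⇒m≤1+n l) , r)
           (λ { refl → ≤-refl , (s≤s z≤n , pd) })
           (λ { (l , _) refl → <-asym l ≤-refl }) ⟩
    ∑ (below q d) f + (f (suc d) + 0)  ≡⟨ cong (∑ (below q d) f +_) (+-identityʳ _) ⟩
    ∑ (below q d) f + f (suc d)        ∎
    where
    open ≡-Reasoning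
    q≢q⁻¹ : ∀ {q} → q ≢ q ℙ.⁻¹
    q≢q⁻¹ {0ℙ} ()
    q≢q⁻¹ {1ℙ} ()
    split : ∀ {b} → Below q (2 + d) b → Below q d b ⊎ (b ≡ suc d)
    split {b} (s≤s l , r@(_ , pb)) with m≤n⇒m<n∨m≡n l
    ... | inj₂ e = inj₂ e
    ... | inj₁ (s≤s l′) with m≤n⇒m<n∨m≡n l′
    ...   | inj₁ l″ = inj₁ (l″ , r)
    ...   | inj₂ refl = contradiction (trans (sym pb) (trans (sym (suc-homo-⁻¹ d)) (cong ℙ._⁻¹ pd))) q≢q⁻¹

  ∑-below-≤1 : ∀ q d (f : ℕ → ℕ) → d ≤ 1 → ∑ (below q d) f ≡ 0
  ∑-below-≤1 q d f d≤1 = ∑-zero (below q d) (λ (l , (b>0 , _)) → contradiction (≤-trans l d≤1) (<⇒≱ (s≤s b>0)))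

  -- The closed form is (d - 1) d (d + 1) / 6. Its lower-order term d is the one that the constant
  -- term of `evenPart` will compensate.
  sumEvenSquares : ∀ d → parity d ≡ 1ℙ → 6 * ∑ (below 0ℙ d) (_^ 2) + d ≡ d ^ 3
  sumEvenSquares 1 _ = cong (λ k → 6 * k + 1) (∑-below-≤1 0ℙ 1 (_^ 2) ≤-refl)
  sumEvenSquares (suc (suc d)) pd = begin
    6 * ∑ (below 0ℙ (2 + d)) (_^ 2) + (2 + d)
      ≡⟨ cong (λ k → 6 * k + (2 + d)) (∑-below-2+ 0ℙ d (_^ 2) psd) ⟩
    6 * (∑ (below 0ℙ d) (_^ 2) + suc d ^ 2) + (2 + d)
      ≡⟨ lem₁ (∑ (below 0ℙ d) (_^ 2)) d ⟩
    (6 * ∑ (below 0ℙ d) (_^ 2) + d) + (6 * suc d ^ 2 + 2)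
      ≡⟨ cong (_+ (6 * suc d ^ 2 + 2)) (sumEvenSquares d pd) ⟩
    d ^ 3 + (6 * suc d ^ 2 + 2)
      ≡⟨ lem₂ d ⟩
    (2 + d) ^ 3 ∎
    where
    open ≡-Reasoning
    psd : parity (suc d) ≡ 0ℙ
    psd = ℙ.⁻¹-injective (trans (suc-homo-⁻¹ d) pd)
    lem₁ : ∀ s d → 6 * (s + (1 + d) * ((1 + d) * 1)) + (2 + d) ≡ (6 * s + d) + (6 * ((1 + d) * ((1 + d) * 1)) + 2)
    lem₁ = solve-∀
    lem₂ : ∀ d → d * (d * (d * 1)) + (6 * ((1 + d) * ((1 + d) * 1)) + 2) ≡ (2 + d) * ((2 + d) * ((2 + d) * 1))
    lem₂ = solve-∀

  countOdds : ∀ d → parity d ≡ 0ℙ → 2 * ∑ (below 1ℙ d) (λ _ → 1) ≡ d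
  countOdds 0 _ = cong (2 *_) (∑-below-≤1 1ℙ 0 (λ _ → 1) z≤n)
  countOdds (suc (suc d)) pd = begin
    2 * ∑ (below 1ℙ (2 + d)) (λ _ → 1)  ≡⟨ cong (2 *_) (∑-below-2+ 1ℙ d (λ _ → 1) psd) ⟩
    2 * (∑ (below 1ℙ d) (λ _ → 1) + 1)  ≡⟨ *-distribˡ-+ 2 (∑ (below 1ℙ d) (λ _ → 1)) 1 ⟩
    2 * ∑ (below 1ℙ d) (λ _ → 1) + 2    ≡⟨ cong (_+ 2) (countOdds d pd) ⟩
    d + 2                               ≡⟨ +-comm d 2 ⟩
    2 + d                               ∎
    where
    open ≡-Reasoning
    psd : parity (suc d) ≡ 1ℙ
    psd = ℙ.⁻¹-injective (trans (suc-homo-⁻¹ d) pd)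

  module _ (n : ℕ) where
    open Solutions n

    -- A factorization n = d e with d = a + b and e = x leaves b < d as the only free variable, and
    -- h d is constant on this fibre.
    ∑-diagonal : ∀ p q r (f h : ℕ → ℕ) →
      ∑ (S p q r r ∩ x≡y?) (onCoeffs (λ a b → f b * h (a + b))) ≡
      ∑ (factorizations n ∩ hasParities? (p ℙ.+ q) r) (λ (d , _) → ∑ (below q d) f * h d)
    ∑-diagonal p q r f h = begin
      ∑ (S p q r r ∩ x≡y?) (onCoeffs (λ a b → f b * h (a + b)))
        ≡⟨ reindex (S p q r r ∩ x≡y?) (fibration (λ (d , _) → below q d) F)
             (λ (a , b , x , y) → (a + b , x) , b) (λ ((d , e) , b) → d ∸ b , b , e , e)
             to from gf fg (λ {(a , b , _)} _ → *-comm (f b) (h (a + b))) ⟩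
      ∑ (fibration (λ (d , _) → below q d) F) (λ ((d , _) , b) → h d * f b)
        ≡⟨ ∑-fibration (λ (d , _) → below q d) F _ ⟩
      ∑ F (λ (d , _) → ∑ (below q d) (λ b → h d * f b))
        ≡⟨ ∑-cong F (λ {(d , _)} _ → trans (∑-* (below q d) (h d) f) (*-comm (h d) _)) ⟩
      ∑ F (λ (d , _) → ∑ (below q d) f * h d) ∎
      where
      open ≡-Reasoning
      F = factorizations n ∩ hasParities? (p ℙ.+ q) r
      to : ∀ {t : Quad} → let (a , b , x , y) = t in Sol p q r r n t × x ≡ y →
           (Factors n (a + b , x) × HasParities (p ℙ.+ q) r (a + b , x)) × Below q (a + b) b
      to {a , b , x , _} (sol ((a>0 , b>0) , (x>0 , _)) eq ((refl , refl) , (refl , _)) , refl) =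
        (factors (<-≤-trans a>0 (m≤m+n a b) , x>0) (trans (*-distribʳ-+ x a b) eq) , (+-homo-+ a b , refl))
        , (m<n+m b a>0 , (b>0 , refl))
      from : ∀ {t : Pair × ℕ} → let ((d , e) , b) = t in
             (Factors n (d , e) × HasParities (p ℙ.+ q) r (d , e)) × Below q d b →
             Sol p q r r n (d ∸ b , b , e , e) × e ≡ e
      from {(d , e) , b} ((factors (d>0 , e>0) eq , (pd , pe)) , (b<d , (b>0 , pb))) =
        sol ((m<n⇒0<n∸m b<d , b>0) , (e>0 , e>0))
          (trans (sym (*-distribʳ-+ e (d ∸ b) b)) (trans (cong (_* e) (m∸n+n≡m (<⇒≤ b<d))) eq))
          ((trans (parity-∸ (<⇒≤ b<d)) (trans (cong₂ ℙ._+_ pd pb) (ℙ+-cancel q p)) , pb) , (pe , pe))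
        , refl
      gf : ∀ {t : Quad} → let (a , b , x , y) = t in Sol p q r r n t × x ≡ y →
           (a + b ∸ b , b , x , x) ≡ t
      gf {a , b , x , _} (_ , refl) = cong (λ k → k , b , x , x) (m+n∸n≡m a b)
      fg : ∀ {t : Pair × ℕ} → let ((d , e) , b) = t in
           (Factors n (d , e) × HasParities (p ℙ.+ q) r (d , e)) × Below q d b →
           ((d ∸ b + b , e) , b) ≡ t
      fg {(d , e) , b} (_ , (b<d , _)) = cong (λ k → (k , e) , b) (m∸n+n≡m (<⇒≤ b<d))

    -- The extra weight `h` lets one power sum serve twice: `h` constant 1 leads to cubes, `h` the
    -- square to fifth powers.
    diagonal-squares : ∀ (h : ℕ → ℕ) →
      6 * ∑ (S 1ℙ 0ℙ 1ℙ 1ℙ ∩ x≡y?) (onCoeffs (λ a b → b ^ 2 * h (a + b))) + divisorSum 1ℙ 1ℙ (λ d → d * h d) n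
      ≡ divisorSum 1ℙ 1ℙ (λ d → d ^ 3 * h d) n
    diagonal-squares h = begin
      6 * ∑ (S 1ℙ 0ℙ 1ℙ 1ℙ ∩ x≡y?) (onCoeffs (λ a b → b ^ 2 * h (a + b))) + ∑ F (λ (d , _) → d * h d)
        ≡⟨ cong (λ k → 6 * k + ∑ F (λ (d , _) → d * h d)) (∑-diagonal 1ℙ 0ℙ 1ℙ (_^ 2) h) ⟩
      6 * ∑ F (λ (d , _) → T d * h d) + ∑ F (λ (d , _) → d * h d)
        ≡⟨ cong (_+ ∑ F (λ (d , _) → d * h d)) (∑-* F 6 (λ (d , _) → T d * h d)) ⟨
      ∑ F (λ (d , _) → 6 * (T d * h d)) + ∑ F (λ (d , _) → d * h d)
        ≡⟨ ∑-+ F _ _ ⟨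
      ∑ F (λ (d , _) → 6 * (T d * h d) + d * h d)
        ≡⟨ ∑-cong F (λ {(d , _)} (_ , (pd , _)) → trans (lem (T d) d (h d)) (cong (_* h d) (sumEvenSquares d pd))) ⟩
      ∑ F (λ (d , _) → d ^ 3 * h d) ∎
      where
      open ≡-Reasoning
      F = factorizations n ∩ hasParities? 1ℙ 1ℙ
      T : ℕ → ℕ
      T d = ∑ (below 0ℙ d) (_^ 2)
      lem : ∀ b d h → 6 * (b * h) + d * h ≡ (6 * b + d) * h
      lem = solve-∀

    24∑ab-odd : divisorSum 1ℙ 1ℙ id n + 24 * ∑ (S 1ℙ 1ℙ 0ℙ 1ℙ) (onCoeffs _*_) ≡ divisorSum 1ℙ 1ℙ (_^ 3) n
    24∑ab-odd = begin
      δ id + 24 * ∑ M (onCoeffs _*_)                          ≡⟨ lem (δ id) (∑ M (onCoeffs _*_)) ⟩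
      6 * (4 * ∑ M (onCoeffs _*_)) + δ id                     ≡⟨ cong₂ (λ k l → 6 * k + l)
        (trans 4∑ab-odd (∑-cong (S 1ℙ 0ℙ 1ℙ 1ℙ ∩ x≡y?) (λ _ → sym (*-identityʳ _))))
        (∑-cong F (λ _ → sym (*-identityʳ _))) ⟩
      6 * ∑ (S 1ℙ 0ℙ 1ℙ 1ℙ ∩ x≡y?) (onCoeffs (λ a b → b ^ 2 * 1)) + δ (λ d → d * 1)
                                                              ≡⟨ diagonal-squares (λ _ → 1) ⟩
      δ (λ d → d ^ 3 * 1)                                     ≡⟨ ∑-cong F (λ _ → *-identityʳ _) ⟩
      δ (_^ 3)                                                ∎
      where
      open ≡-Reasoning
      F = factorizations n ∩ hasParities? 1ℙ 1ℙ
      M = S 1ℙ 1ℙ 0ℙ 1ℙ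
      δ : (ℕ → ℕ) → ℕ
      δ f = divisorSum 1ℙ 1ℙ f n
      lem : ∀ d m → d + 24 * m ≡ 6 * (4 * m) + d
      lem = solve-∀

    24∑ab³ : divisorSum 1ℙ 1ℙ (_^ 3) n +
             24 * (∑ (S 1ℙ 1ℙ 0ℙ 1ℙ) (onCoeffs (λ a b → a * b ^ 3)) + ∑ (S 1ℙ 0ℙ 1ℙ 1ℙ) (onCoeffs (λ a b → a * b ^ 3)))
             ≡ divisorSum 1ℙ 1ℙ (_^ 5) n
    24∑ab³ = begin
      δ (_^ 3) + 24 * U                         ≡⟨ lem (δ (_^ 3)) U ⟩
      6 * (4 * U) + δ (_^ 3)                    ≡⟨ cong (λ k → 6 * k + δ (_^ 3)) (trans 4∑ab³
        (∑-cong (S 1ℙ 0ℙ 1ℙ 1ℙ ∩ x≡y?) (λ {(a , b , _)} _ → square-* b (a + b)))) ⟩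
      6 * ∑ (S 1ℙ 0ℙ 1ℙ 1ℙ ∩ x≡y?) (onCoeffs (λ a b → b ^ 2 * (a + b) ^ 2)) + δ (_^ 3)
                                                ≡⟨ diagonal-squares (_^ 2) ⟩
      δ (λ d → d ^ 3 * d ^ 2)                   ≡⟨ ∑-cong F (λ {(d , _)} _ → sym (^-distribˡ-+-* d 3 2)) ⟩
      δ (_^ 5)                                  ∎
      where
      open ≡-Reasoning
      F = factorizations n ∩ hasParities? 1ℙ 1ℙ
      δ : (ℕ → ℕ) → ℕ
      δ f = divisorSum 1ℙ 1ℙ f n
      U : ℕ
      U = ∑ (S 1ℙ 1ℙ 0ℙ 1ℙ) (onCoeffs (λ a b → a * b ^ 3)) + ∑ (S 1ℙ 0ℙ 1ℙ 1ℙ) (onCoeffs (λ a b → a * b ^ 3))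
      lem : ∀ d m → d + 24 * m ≡ 6 * (4 * m) + d
      lem = solve-∀

    -- Here 8 = 4 · 2. The odd numbers below an even d number exactly d / 2, so no lower-order term
    -- appears.
    8∑ab-even : 8 * ∑ (S 1ℙ 1ℙ 1ℙ 1ℙ) (onCoeffs _*_) ≡ divisorSum 0ℙ 1ℙ (_^ 3) n
    8∑ab-even = begin
      8 * ∑ (S 1ℙ 1ℙ 1ℙ 1ℙ) (onCoeffs _*_)        ≡⟨ *-assoc 2 4 (∑ (S 1ℙ 1ℙ 1ℙ 1ℙ) (onCoeffs _*_)) ⟩
      2 * (4 * ∑ (S 1ℙ 1ℙ 1ℙ 1ℙ) (onCoeffs _*_))  ≡⟨ cong (2 *_) (trans 4∑ab-even
        (∑-cong (S 1ℙ 1ℙ 1ℙ 1ℙ ∩ x≡y?) (λ _ → sym (*-identityˡ _)))) ⟩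
      2 * ∑ (S 1ℙ 1ℙ 1ℙ 1ℙ ∩ x≡y?) (onCoeffs (λ a b → 1 * (a + b) ^ 2))
                                                  ≡⟨ cong (2 *_) (∑-diagonal 1ℙ 1ℙ 1ℙ (λ _ → 1) (_^ 2)) ⟩
      2 * ∑ F (λ (d , _) → T d * d ^ 2)           ≡⟨ ∑-* F 2 _ ⟨
      ∑ F (λ (d , _) → 2 * (T d * d ^ 2))
        ≡⟨ ∑-cong F (λ {(d , _)} (_ , (pd , _)) → trans (sym (*-assoc 2 (T d) _)) (cong (_* d ^ 2) (countOdds d pd))) ⟩
      divisorSum 0ℙ 1ℙ (_^ 3) n                   ∎
      where
      open ≡-Reasoning
      F = factorizations n ∩ hasParities? 0ℙ 1ℙ
      T : ℕ → ℕ
      T d = ∑ (below 1ℙ d) (λ _ → 1)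

  -- Cauchy products

  abstract
    antidiagonal : ∀ n → Enum {ℕ × ℕ} (λ (i , j) → i + j ≡ n)
    antidiagonal n = relabel {A = ℕ × ℕ} {P = λ t → (proj₁ t < suc n × proj₂ t < suc n) × proj₁ t + proj₂ t ≡ n}
      proj₂ (λ { {i , j} refl → (s≤s (m≤m+n i j) , s≤s (m≤n+m j i)) , refl })
      (upto (suc n) ⊗ upto (suc n) ∩ (λ (i , j) → i + j ≟ n))

    -- The enumeration is built by the same expression as `pairs`, which is visible only inside this
    -- block.
    ∑-antidiagonal : ∀ n (w : ℕ × ℕ → ℕ) → ∑ (antidiagonal n) w ≡ sum (map w (pairs n))
    ∑-antidiagonal n w = refl

    antidiagonal₃ : ∀ n → Enum {ℕ × ℕ × ℕ} (λ (i , j , k) → i + j + k ≡ n)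
    antidiagonal₃ n = relabel
      {A = ℕ × ℕ × ℕ} {P = λ (i , j , k) → (i < suc n × j < suc n × k < suc n) × i + j + k ≡ n}
      proj₂
      (λ { {i , j , k} refl →
        (s≤s (≤-trans (m≤m+n i j) (m≤m+n (i + j) k)) ,
         s≤s (≤-trans (m≤n+m j i) (m≤m+n (i + j) k)) , s≤s (m≤n+m k (i + j))) , refl })
      (upto (suc n) ⊗ upto (suc n) ⊗ upto (suc n) ∩ (λ (i , j , k) → i + j + k ≟ n))

    ∑-antidiagonal₃ : ∀ n (w : ℕ × ℕ × ℕ → ℕ) → ∑ (antidiagonal₃ n) w ≡ sum (map w (triples n))
    ∑-antidiagonal₃ n w = refl

  infixr 7 _⋆_
  _⋆_ : (ℕ → ℕ) → (ℕ → ℕ) → ℕ → ℕ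
  (f ⋆ g) n = ∑ (antidiagonal n) (λ (i , j) → f i * g j)

  ⋆-cong : ∀ {f f′ g g′} → f ≗ f′ → g ≗ g′ → f ⋆ g ≗ f′ ⋆ g′
  ⋆-cong f≗ g≗ n = ∑-cong (antidiagonal n) (λ {(i , j)} _ → cong₂ _*_ (f≗ i) (g≗ j))

  ⋆-comm : ∀ f g → f ⋆ g ≗ g ⋆ f
  ⋆-comm f g n = reindex (antidiagonal n) (antidiagonal n) (λ (i , j) → j , i) (λ (i , j) → j , i)
    (λ {(i , j)} e → trans (+-comm j i) e) (λ {(i , j)} e → trans (+-comm j i) e)
    (λ _ → refl) (λ _ → refl) (λ {(i , j)} _ → *-comm (f i) (g j))

  ⋆-distribˡ : ∀ f g h → f ⋆ (λ i → g i + h i) ≗ λ n → (f ⋆ g) n + (f ⋆ h) n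
  ⋆-distribˡ f g h n = trans
    (∑-cong (antidiagonal n) (λ {(i , j)} _ → *-distribˡ-+ (f i) (g j) (h j)))
    (∑-+ (antidiagonal n) _ _)

  ⋆-distribʳ : ∀ f g h → (λ i → f i + g i) ⋆ h ≗ λ n → (f ⋆ h) n + (g ⋆ h) n
  ⋆-distribʳ f g h n = trans
    (∑-cong (antidiagonal n) (λ {(i , j)} _ → *-distribʳ-+ (h j) (f i) (g i)))
    (∑-+ (antidiagonal n) _ _)

  ⋆-scale : ∀ c d f g → (λ i → c * f i) ⋆ (λ i → d * g i) ≗ λ n → c * d * (f ⋆ g) n
  ⋆-scale c d f g n = trans
    (∑-cong (antidiagonal n) (λ {(i , j)} _ → lem c d (f i) (g j)))
    (∑-* (antidiagonal n) (c * d) _)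
    where
    lem : ∀ c d x y → c * x * (d * y) ≡ c * d * (x * y)
    lem = solve-∀

  -- The power series 1, the unit of `_⋆_`.
  ε : ℕ → ℕ
  ε zero    = 1
  ε (suc _) = 0

  ⋆-identityˡ : ∀ f → ε ⋆ f ≗ f
  ⋆-identityˡ f n = begin
    ∑ (antidiagonal n) w
      ≡⟨ ∑-⊎ (antidiagonal n) (singleton (0 , n)) (antidiagonal n ∩ (λ (i , j) → 0 <? i)) w
           split (λ { refl → refl }) proj₁ (λ { refl (_ , ()) }) ⟩
    w (0 , n) + 0 + ∑ (antidiagonal n ∩ (λ (i , j) → 0 <? i)) w
      ≡⟨ cong (w (0 , n) + 0 +_) (∑-zero (antidiagonal n ∩ (λ (i , j) → 0 <? i)) λ { {suc i , j} _ → refl }) ⟩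
    w (0 , n) + 0 + 0
      ≡⟨ lem (f n) ⟩
    f n ∎
    where
    open ≡-Reasoning
    w : ℕ × ℕ → ℕ
    w (i , j) = ε i * f j
    lem : ∀ x → 1 * x + 0 + 0 ≡ x
    lem = solve-∀
    split : ∀ {t : ℕ × ℕ} → proj₁ t + proj₂ t ≡ n → (t ≡ (0 , n)) ⊎ (proj₁ t + proj₂ t ≡ n × 0 < proj₁ t)
    split {zero  , j} refl = inj₁ refl
    split {suc i , j} e    = inj₂ (e , s≤s z≤n)

  triple⋆ : ∀ f g h n → ∑ (antidiagonal₃ n) (λ (i , j , k) → f i * g j * h k) ≡ (f ⋆ g ⋆ h) n
  triple⋆ f g h n = begin
    ∑ (antidiagonal₃ n) (λ (i , j , k) → f i * g j * h k)
      ≡⟨ reindex (antidiagonal₃ n) (fibration (λ (_ , m) → antidiagonal m) (antidiagonal n))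
           (λ (i , j , k) → (i , j + k) , (j , k)) (λ ((i , m) , (j , k)) → i , j , k)
           (λ {(i , j , k)} e → trans (sym (+-assoc i j k)) e , refl)
           (λ { {(i , _) , (j , k)} (e , refl) → trans (+-assoc i j k) e })
           (λ _ → refl) (λ { (_ , refl) → refl }) (λ {(i , j , k)} _ → *-assoc (f i) (g j) (h k)) ⟩
    ∑ (fibration (λ (_ , m) → antidiagonal m) (antidiagonal n)) (λ ((i , _) , (j , k)) → f i * (g j * h k))
      ≡⟨ ∑-fibration (λ (_ , m) → antidiagonal m) (antidiagonal n) _ ⟩
    ∑ (antidiagonal n) (λ (i , m) → ∑ (antidiagonal m) (λ (j , k) → f i * (g j * h k)))
      ≡⟨ ∑-cong (antidiagonal n) (λ {(i , m)} _ → ∑-* (antidiagonal m) (f i) _) ⟩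
    (f ⋆ g ⋆ h) n ∎
    where open ≡-Reasoning

  -- The unbracketed triple sum is visibly symmetric in its first two indices.
  ⋆-leftComm : ∀ f g h → f ⋆ g ⋆ h ≗ g ⋆ f ⋆ h
  ⋆-leftComm f g h n = begin
    (f ⋆ g ⋆ h) n                                          ≡⟨ triple⋆ f g h n ⟨
    ∑ (antidiagonal₃ n) (λ (i , j , k) → f i * g j * h k)
      ≡⟨ reindex (antidiagonal₃ n) (antidiagonal₃ n) (λ (i , j , k) → j , i , k) (λ (i , j , k) → j , i , k)
           (λ {(i , j , k)} e → trans (cong (_+ k) (+-comm j i)) e)
           (λ {(i , j , k)} e → trans (cong (_+ k) (+-comm j i)) e)
           (λ _ → refl) (λ _ → refl) (λ {(i , j , k)} _ → cong (_* h k) (*-comm (f i) (g j))) ⟩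
    ∑ (antidiagonal₃ n) (λ (j , i , k) → g j * f i * h k)  ≡⟨ triple⋆ g f h n ⟩
    (g ⋆ f ⋆ h) n                                          ∎
    where open ≡-Reasoning

  -- A term of the product chooses i + j = n, i = a x and j = b y. The solution (a, b, x, y)
  -- recovers i and j.
  divisorSum-⋆ : ∀ p q r s (f g : ℕ → ℕ) n →
    (divisorSum p r f ⋆ divisorSum q s g) n ≡ ∑ (solutions p q r s n) (onCoeffs (λ a b → f a * g b))
  divisorSum-⋆ p q r s f g n = begin
    ∑ (antidiagonal n) (λ (i , j) → divisorSum p r f i * divisorSum q s g j)
      ≡⟨ ∑-cong (antidiagonal n) (λ {(i , j)} _ → ∑-product (F p r i) (F q s j) (f ∘ proj₁) (g ∘ proj₁)) ⟨
    ∑ (antidiagonal n) (λ (i , j) → ∑ (F p r i ⊗ F q s j) (λ ((a , _) , (b , _)) → f a * g b))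
      ≡⟨ ∑-fibration (λ (i , j) → F p r i ⊗ F q s j) (antidiagonal n) (λ (_ , ((a , _) , (b , _))) → f a * g b) ⟨
    ∑ (fibration (λ (i , j) → F p r i ⊗ F q s j) (antidiagonal n)) (λ (_ , ((a , _) , (b , _))) → f a * g b)
      ≡⟨ reindex (fibration (λ (i , j) → F p r i ⊗ F q s j) (antidiagonal n)) (solutions p q r s n)
           (λ (_ , ((a , x) , (b , y))) → a , b , x , y)
           (λ (a , b , x , y) → (a * x , b * y) , ((a , x) , (b , y)))
           (λ { (refl , ((factors (u , v) refl , (e₁ , e₂)) , (factors (u′ , v′) refl , (e₃ , e₄)))) →
                sol ((u , u′) , (v , v′)) refl ((e₁ , e₃) , (e₂ , e₄)) })
           (λ { (sol ((u , u′) , (v , v′)) eq ((e₁ , e₃) , (e₂ , e₄))) →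
                eq , ((factors (u , v) refl , (e₁ , e₂)) , (factors (u′ , v′) refl , (e₃ , e₄))) })
           (λ { (refl , ((factors _ refl , _) , (factors _ refl , _))) → refl })
           (λ _ → refl) (λ _ → refl) ⟩
    ∑ (solutions p q r s n) (onCoeffs (λ a b → f a * g b)) ∎
    where
    open ≡-Reasoning
    F : ∀ p q n → Enum (λ t → Factors n t × HasParities p q t)
    F p q n = factorizations n ∩ hasParities? p q

  -- Support in a residue class modulo 2

  -- The grading of power series by the parity of exponents. It is additive under `_⋆_` and discards
  -- half of the terms of the square and the cube.
  SupportedOn : Parity → (ℕ → ℕ) → Set
  SupportedOn p f = ∀ n → parity n ≢ p → f n ≡ 0

  ⋆-supported : ∀ {p q f g} → SupportedOn p f → SupportedOn q g → SupportedOn (p ℙ.+ q) (f ⋆ g)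
  ⋆-supported {p} {q} {f} {g} F G n n≢ = ∑-zero (antidiagonal n) vanish
    where
    vanish : ∀ {t : ℕ × ℕ} → proj₁ t + proj₂ t ≡ n → f (proj₁ t) * g (proj₂ t) ≡ 0
    vanish {i , j} refl with parity i ℙ.≟ p | parity j ℙ.≟ q
    ... | no i≢  | _      = cong (_* g j) (F i i≢)
    ... | yes _  | no j≢  = trans (cong (f i *_) (G j j≢)) (*-zeroʳ (f i))
    ... | yes pi | yes pj = contradiction (trans (+-homo-+ i j) (cong₂ ℙ._+_ pi pj)) n≢

  divisorSum-supported : ∀ p q f → SupportedOn (p ℙ.* q) (divisorSum p q f)
  divisorSum-supported p q f n n≢ = ∑-zero (factorizations n ∩ hasParities? p q)
    (λ { {d , e} (factors _ refl , (pd , pe)) → contradiction (trans (*-homo-* d e) (cong₂ ℙ._*_ pd pe)) n≢ })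

  scale-supported : ∀ {p f} c → SupportedOn p f → SupportedOn p (λ n → c * f n)
  scale-supported c F n n≢ = trans (cong (c *_) (F n n≢)) (*-zeroʳ c)

  +-supported : ∀ {p f g} → SupportedOn p f → SupportedOn p g → SupportedOn p (λ n → f n + g n)
  +-supported F G n n≢ = cong₂ _+_ (F n n≢) (G n n≢)

  ε-supported : SupportedOn 0ℙ ε
  ε-supported zero    n≢ = contradiction refl n≢
  ε-supported (suc n) _  = refl

  -- The square and the cube of the scaled series

  -- scaledσ̂ is 24 σ̂, with value 1 at 0 coming from ε.
  oddPart evenPart scaledσ̂ : ℕ → ℕ
  oddPart n  = 24 * divisorSum 1ℙ 1ℙ id n
  evenPart n = ε n + 24 * divisorSum 1ℙ 0ℙ id n
  scaledσ̂ n  = oddPart n + evenPart n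

  oddPart-supported : SupportedOn 1ℙ oddPart
  oddPart-supported = scale-supported 24 (divisorSum-supported 1ℙ 1ℙ id)

  evenPart-supported : SupportedOn 0ℙ evenPart
  evenPart-supported = +-supported {f = ε} ε-supported (scale-supported 24 (divisorSum-supported 1ℙ 0ℙ id))

  -- The constant term of `evenPart` reproduces the divisor sum, and the rest gives solutions with
  -- a, b, y odd and x even. The former is the summand by which 24 ∑ a f(b) alone falls short.
  evenPart⋆ : ∀ f → evenPart ⋆ (λ n → 24 * divisorSum 1ℙ 1ℙ f n) ≗
              λ n → 24 * (divisorSum 1ℙ 1ℙ f n + 24 * ∑ (solutions 1ℙ 1ℙ 0ℙ 1ℙ n) (onCoeffs (λ a b → a * f b)))
  evenPart⋆ f n = begin
    (evenPart ⋆ (λ n → 24 * δ n)) n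
      ≡⟨ ⋆-distribʳ ε (λ n → 24 * divisorSum 1ℙ 0ℙ id n) (λ n → 24 * δ n) n ⟩
    (ε ⋆ (λ n → 24 * δ n)) n + ((λ n → 24 * divisorSum 1ℙ 0ℙ id n) ⋆ (λ n → 24 * δ n)) n
      ≡⟨ cong₂ _+_ (⋆-identityˡ (λ n → 24 * δ n) n)
           (trans (⋆-scale 24 24 (divisorSum 1ℙ 0ℙ id) δ n) (cong (24 * 24 *_) (divisorSum-⋆ 1ℙ 1ℙ 0ℙ 1ℙ id f n))) ⟩
    24 * δ n + 24 * 24 * s
      ≡⟨ lem (δ n) s ⟩
    24 * (δ n + 24 * s) ∎
    where
    open ≡-Reasoning
    δ : ℕ → ℕ
    δ = divisorSum 1ℙ 1ℙ f
    s : ℕ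
    s = ∑ (solutions 1ℙ 1ℙ 0ℙ 1ℙ n) (onCoeffs (λ a b → a * f b))
    lem : ∀ d s → 24 * d + 24 * 24 * s ≡ 24 * (d + 24 * s)
    lem = solve-∀

  evenPart⋆oddPart : evenPart ⋆ oddPart ≗ λ n → 24 * divisorSum 1ℙ 1ℙ (_^ 3) n
  evenPart⋆oddPart n = trans (evenPart⋆ id n) (cong (24 *_) (24∑ab-odd n))

  oddPart⋆oddPart : oddPart ⋆ oddPart ≗ λ n → 72 * divisorSum 0ℙ 1ℙ (_^ 3) n
  oddPart⋆oddPart n = begin
    (oddPart ⋆ oddPart) n                                      ≡⟨ ⋆-scale 24 24 δ δ n ⟩
    24 * 24 * (δ ⋆ δ) n                                        ≡⟨ cong (24 * 24 *_) (divisorSum-⋆ 1ℙ 1ℙ 1ℙ 1ℙ id id n) ⟩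
    24 * 24 * s                                                ≡⟨ lem s ⟩
    72 * (8 * s)                                               ≡⟨ cong (72 *_) (8∑ab-even n) ⟩
    72 * divisorSum 0ℙ 1ℙ (_^ 3) n                             ∎
    where
    open ≡-Reasoning
    δ : ℕ → ℕ
    δ = divisorSum 1ℙ 1ℙ id
    s : ℕ
    s = ∑ (solutions 1ℙ 1ℙ 1ℙ 1ℙ n) (onCoeffs _*_)
    lem : ∀ s → 24 * 24 * s ≡ 72 * (8 * s)
    lem = solve-∀

  module _ (n : ℕ) (n-odd : parity n ≡ 1ℙ) where

    private
      vanishes : ∀ {f} → SupportedOn 0ℙ f → f n ≡ 0
      vanishes F = F n (λ n-even → contradiction (trans (sym n-even) n-odd) λ ())

      oddTerm evenTerm : ℕ → ℕ
      oddTerm n  = 2 * (evenPart ⋆ oddPart) n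
      evenTerm n = (oddPart ⋆ oddPart) n + (evenPart ⋆ evenPart) n

    -- Grouped so that one summand lives on odd and the other on even exponents; this grouping is
    -- used again inside the cube.
    square-split : scaledσ̂ ⋆ scaledσ̂ ≗ λ n → oddTerm n + evenTerm n
    square-split n = begin
      (scaledσ̂ ⋆ scaledσ̂) n
        ≡⟨ ⋆-distribʳ o e scaledσ̂ n ⟩
      (o ⋆ scaledσ̂) n + (e ⋆ scaledσ̂) n
        ≡⟨ cong₂ _+_ (⋆-distribˡ o o e n) (⋆-distribˡ e o e n) ⟩
      ((o ⋆ o) n + (o ⋆ e) n) + ((e ⋆ o) n + (e ⋆ e) n)
        ≡⟨ cong (λ k → ((o ⋆ o) n + k) + ((e ⋆ o) n + (e ⋆ e) n)) (⋆-comm o e n) ⟩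
      ((o ⋆ o) n + (e ⋆ o) n) + ((e ⋆ o) n + (e ⋆ e) n)
        ≡⟨ lem ((o ⋆ o) n) ((e ⋆ o) n) ((e ⋆ e) n) ⟩
      2 * (e ⋆ o) n + ((o ⋆ o) n + (e ⋆ e) n) ∎
      where
      open ≡-Reasoning
      o = oddPart
      e = evenPart
      lem : ∀ x y z → (x + y) + (y + z) ≡ 2 * y + (x + z)
      lem = solve-∀

    evenTerm-supported : SupportedOn 0ℙ evenTerm
    evenTerm-supported = +-supported (⋆-supported {f = oddPart} {oddPart} oddPart-supported oddPart-supported)
      (⋆-supported {f = evenPart} {evenPart} evenPart-supported evenPart-supported)

    oddTerm-supported : SupportedOn 1ℙ oddTerm
    oddTerm-supported = scale-supported 2 (⋆-supported {f = evenPart} {oddPart} evenPart-supported oddPart-supported)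

    scaledσ̂⋆² : (scaledσ̂ ⋆ scaledσ̂) n ≡ 48 * divisorSum 1ℙ 1ℙ (_^ 3) n
    scaledσ̂⋆² = begin
      (scaledσ̂ ⋆ scaledσ̂) n                   ≡⟨ square-split n ⟩
      2 * (evenPart ⋆ oddPart) n + evenTerm n ≡⟨ cong₂ (λ k l → 2 * k + l) (evenPart⋆oddPart n) (vanishes evenTerm-supported) ⟩
      2 * (24 * δ) + 0                        ≡⟨ lem δ ⟩
      48 * δ                                  ∎
      where
      open ≡-Reasoning
      δ = divisorSum 1ℙ 1ℙ (_^ 3) n
      lem : ∀ d → 2 * (24 * d) + 0 ≡ 48 * d
      lem = solve-∀

    -- At odd n only o³ + 3 e² o survives. As o² carries 72 and e o carries 24, o³ is 72 · 24 `N`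
    -- and 3 e² o is 72 (`δ` + 24 `M`). The common factor 72 leaves exactly the left side of
    -- `24∑ab³`.
    scaledσ̂⋆³ : (scaledσ̂ ⋆ scaledσ̂ ⋆ scaledσ̂) n ≡ 72 * divisorSum 1ℙ 1ℙ (_^ 5) n
    scaledσ̂⋆³ = begin
      (scaledσ̂ ⋆ scaledσ̂ ⋆ scaledσ̂) n
        ≡⟨ ⋆-cong {f = scaledσ̂} (λ _ → refl) square-split n ⟩
      (scaledσ̂ ⋆ (λ n → oddTerm n + evenTerm n)) n
        ≡⟨ trans (⋆-distribʳ o e _ n) (cong₂ _+_ (⋆-distribˡ o oddTerm evenTerm n) (⋆-distribˡ e oddTerm evenTerm n)) ⟩
      ((o ⋆ oddTerm) n + (o ⋆ evenTerm) n) + ((e ⋆ oddTerm) n + (e ⋆ evenTerm) n)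
        ≡⟨ cong₂ (λ k l → (k + (o ⋆ evenTerm) n) + ((e ⋆ oddTerm) n + l))
             (vanishes (⋆-supported {f = o} {oddTerm} oddPart-supported oddTerm-supported))
             (vanishes (⋆-supported {f = e} {evenTerm} evenPart-supported evenTerm-supported)) ⟩
      (o ⋆ evenTerm) n + ((e ⋆ oddTerm) n + 0)
        ≡⟨ cong₂ (λ k l → k + (l + 0)) (⋆-distribˡ o (o ⋆ o) (e ⋆ e) n) eeo₂ ⟩
      ((o ⋆ o ⋆ o) n + (o ⋆ e ⋆ e) n) + (2 * (e ⋆ e ⋆ o) n + 0)
        ≡⟨ cong (λ k → ((o ⋆ o ⋆ o) n + k) + (2 * (e ⋆ e ⋆ o) n + 0)) oee ⟩
      ((o ⋆ o ⋆ o) n + (e ⋆ e ⋆ o) n) + (2 * (e ⋆ e ⋆ o) n + 0)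
        ≡⟨ cong₂ (λ k l → (k + l) + (2 * l + 0)) ooo eeo ⟩
      (24 * 72 * N + 24 * (δ + 24 * M)) + (2 * (24 * (δ + 24 * M)) + 0)
        ≡⟨ lem δ M N ⟩
      72 * (δ + 24 * (M + N))
        ≡⟨ cong (72 *_) (24∑ab³ n) ⟩
      72 * divisorSum 1ℙ 1ℙ (_^ 5) n ∎
      where
      open ≡-Reasoning
      o = oddPart
      e = evenPart
      δ M N : ℕ
      δ = divisorSum 1ℙ 1ℙ (_^ 3) n
      M = ∑ (solutions 1ℙ 1ℙ 0ℙ 1ℙ n) (onCoeffs (λ a b → a * b ^ 3))
      N = ∑ (solutions 1ℙ 0ℙ 1ℙ 1ℙ n) (onCoeffs (λ a b → a * b ^ 3))
      ooo : (o ⋆ o ⋆ o) n ≡ 24 * 72 * N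
      ooo = begin
        (o ⋆ o ⋆ o) n                                                ≡⟨ ⋆-cong {f = o} (λ _ → refl) oddPart⋆oddPart n ⟩
        (o ⋆ (λ n → 72 * divisorSum 0ℙ 1ℙ (_^ 3) n)) n               ≡⟨ ⋆-scale 24 72 (divisorSum 1ℙ 1ℙ id) (divisorSum 0ℙ 1ℙ (_^ 3)) n ⟩
        24 * 72 * (divisorSum 1ℙ 1ℙ id ⋆ divisorSum 0ℙ 1ℙ (_^ 3)) n  ≡⟨ cong (24 * 72 *_) (divisorSum-⋆ 1ℙ 0ℙ 1ℙ 1ℙ id (_^ 3) n) ⟩
        24 * 72 * N                                                  ∎
      eeo : (e ⋆ e ⋆ o) n ≡ 24 * (δ + 24 * M)
      eeo = trans (⋆-cong {f = e} (λ _ → refl) evenPart⋆oddPart n) (evenPart⋆ (_^ 3) n)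
      oee : (o ⋆ e ⋆ e) n ≡ (e ⋆ e ⋆ o) n
      oee = trans (⋆-leftComm o e e n) (⋆-cong {f = e} (λ _ → refl) (⋆-comm o e) n)
      eeo₂ : (e ⋆ oddTerm) n ≡ 2 * (e ⋆ e ⋆ o) n
      -- `⋆-scale` scales both factors, so `e` receives the coefficient 1.
      eeo₂ = trans (⋆-cong {f = e} {λ n → 1 * e n} (λ n → sym (*-identityˡ (e n))) (λ _ → refl) n)
                   (⋆-scale 1 2 e (e ⋆ o) n)
      lem : ∀ d m n → (24 * 72 * n + 24 * (d + 24 * m)) + (2 * (24 * (d + 24 * m)) + 0) ≡ 72 * (d + 24 * (m + n))
      lem = solve-∀

  -- The alternating divisor sum as a sum of odd divisors

  first? second? : (p : Parity) → Decidable {A = Pair} _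
  first? p (d , e) = parity d ℙ.≟ p
  second? p (d , e) = parity e ℙ.≟ p

  -- Moving a factor 2 from an even cofactor to the divisor is a bijection that doubles the divisor.
  ∑-firstEven : ∀ n → let F = factorizations n in
                ∑ (F ∩ first? 0ℙ) proj₁ ≡ ∑ (F ∩ second? 0ℙ) proj₁ + ∑ (F ∩ second? 0ℙ) proj₁
  ∑-firstEven n = begin
    ∑ (F ∩ first? 0ℙ) proj₁
      ≡⟨ reindex (F ∩ second? 0ℙ) (F ∩ first? 0ℙ)
           (λ (d , e) → d + d , ⌊ e /2⌋) (λ (d , e) → ⌊ d /2⌋ , e + e) to from
           (λ { {d , e} (_ , pe) → cong₂ _,_ (sym (n≡⌊n+n/2⌋ d)) (half+half e pe) })
           (λ { {d , e} (_ , pd) → cong₂ _,_ (half+half d pd) (sym (n≡⌊n+n/2⌋ e)) })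
           (λ _ → refl) ⟨
    ∑ (F ∩ second? 0ℙ) (λ (d , _) → d + d)
      ≡⟨ ∑-+ (F ∩ second? 0ℙ) proj₁ proj₁ ⟩
    ∑ (F ∩ second? 0ℙ) proj₁ + ∑ (F ∩ second? 0ℙ) proj₁ ∎
    where
    open ≡-Reasoning
    F = factorizations n
    half>0 : ∀ {m} → 0 < m → parity m ≡ 0ℙ → 0 < ⌊ m /2⌋
    half>0 {suc (suc m)} _ _ = s≤s z≤n
    double>0 : ∀ {m} → 0 < m → 0 < m + m
    double>0 {suc m} _ = s≤s z≤n
    halfʳ : ∀ d e → parity e ≡ 0ℙ → (d + d) * ⌊ e /2⌋ ≡ d * e
    halfʳ d e pe = trans (lem d ⌊ e /2⌋) (cong (d *_) (half+half e pe))
      where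
      lem : ∀ d h → (d + d) * h ≡ d * (h + h)
      lem = solve-∀
    to : ∀ {t : Pair} → let (d , e) = t in Factors n t × parity e ≡ 0ℙ →
         Factors n (d + d , ⌊ e /2⌋) × parity (d + d) ≡ 0ℙ
    to {d , e} (factors (d>0 , e>0) eq , pe) =
      factors (double>0 d>0 , half>0 e>0 pe) (trans (halfʳ d e pe) eq) , parity-n+n d
    from : ∀ {t : Pair} → let (d , e) = t in Factors n t × parity d ≡ 0ℙ →
           Factors n (⌊ d /2⌋ , e + e) × parity (e + e) ≡ 0ℙ
    from {d , e} (factors (d>0 , e>0) eq , pd) =
      factors (half>0 d>0 pd , double>0 e>0)
        (trans (*-comm ⌊ d /2⌋ (e + e)) (trans (halfʳ e d pd) (trans (*-comm e d) eq))) , parity-n+n e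

  -- Split the sum of all divisors by the parity of the divisor and by that of the cofactor. The
  -- even divisors contribute 2 `v`, so cancelling one `v` shows that the odd divisors sum to the
  -- odd-cofactor part minus the even-cofactor part, which is σ̂.
  ∑-firstOdd : ∀ n → let F = factorizations n in
               ∑ (F ∩ first? 1ℙ) proj₁ + ∑ (F ∩ second? 0ℙ) proj₁ ≡ ∑ (F ∩ second? 1ℙ) proj₁
  ∑-firstOdd n = +-cancelʳ-≡ v (∑ (F ∩ first? 1ℙ) proj₁ + v) (∑ (F ∩ second? 1ℙ) proj₁) (begin
    ∑ (F ∩ first? 1ℙ) proj₁ + v + v                        ≡⟨ +-assoc (∑ (F ∩ first? 1ℙ) proj₁) v v ⟩
    ∑ (F ∩ first? 1ℙ) proj₁ + (v + v)                      ≡⟨ cong (λ k → ∑ (F ∩ first? 1ℙ) proj₁ + k) (∑-firstEven n) ⟨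
    ∑ (F ∩ first? 1ℙ) proj₁ + ∑ (F ∩ first? 0ℙ) proj₁      ≡⟨ ∑-parity F proj₁ proj₁ ⟨
    ∑ F proj₁                                              ≡⟨ ∑-parity F proj₂ proj₁ ⟩
    ∑ (F ∩ second? 1ℙ) proj₁ + v                           ∎)
    where
    open ≡-Reasoning
    F = factorizations n
    v : ℕ
    v = ∑ (F ∩ second? 0ℙ) proj₁

  ∑-firstOdd-divisorSum : ∀ n → ∑ (factorizations n ∩ first? 1ℙ) proj₁ ≡ divisorSum 1ℙ 1ℙ id n + divisorSum 1ℙ 0ℙ id n
  ∑-firstOdd-divisorSum n = trans (∑-parity (F ∩ first? 1ℙ) proj₂ proj₁) (cong₂ _+_ (collect 1ℙ) (collect 0ℙ))
    where
    F = factorizations n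
    collect : ∀ q → ∑ (F ∩ first? 1ℙ ∩ second? q) proj₁ ≡ divisorSum 1ℙ q id n
    collect q = ∑-≡ (F ∩ first? 1ℙ ∩ second? q) (F ∩ hasParities? 1ℙ q)
      (λ ((f , pd) , pe) → f , (pd , pe)) (λ (f , (pd , pe)) → (f , pd) , pe) (λ _ → refl)

  module _ (m : ℕ) where

    private
      n = suc m

    divisors : Enum (λ e → suc e ∣ n)
    divisors = record
      { list = divisorPreds n
      ; unique = Unique.filter⁺ (λ e → suc e ∣? n) (Unique.upTo⁺ n)
      ; sound = λ i → proj₂ (∈-filter⁻ (λ e → suc e ∣? n) {xs = upTo n} i)
      ; complete = λ d → ∈-filter⁺ (λ e → suc e ∣? n) (∈-upTo⁺ (∣⇒≤ d)) d
      }

    cofactor : ℕ → Pair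
    cofactor e = suc e , n / suc e

    cofactor-Factors : ∀ {e} → suc e ∣ n → Factors n (cofactor e)
    cofactor-Factors {e} d = factors (s≤s z≤n , n≢0⇒n>0 nonzero) eq
      where
      eq : suc e * (n / suc e) ≡ n
      eq = m*[n/m]≡n d
      nonzero : n / suc e ≢ 0
      nonzero z = contradiction (trans (sym eq) (trans (cong (suc e *_) z) (*-zeroʳ (suc e)))) λ ()

    cofactor-unique : ∀ d {e} → suc d * e ≡ n → e ≡ n / suc d
    cofactor-unique d {e} eq = begin
      e                  ≡⟨ m*n/n≡m e (suc d) ⟨
      e * suc d / suc d  ≡⟨ cong (_/ suc d) (trans (*-comm e (suc d)) eq) ⟩
      n / suc d          ∎
      where open ≡-Reasoning

    ∑-divisors : ∀ {C : Pair → Set} (C? : Decidable C) (w : ℕ → ℕ) →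
                 ∑ (divisors ∩ (C? ∘ cofactor)) (w ∘ suc) ≡ ∑ (factorizations n ∩ C?) (w ∘ proj₁)
    ∑-divisors {C} C? w = reindex (divisors ∩ (C? ∘ cofactor)) (factorizations n ∩ C?)
      cofactor (pred ∘ proj₁)
      (λ (d , c) → cofactor-Factors d , c) from
      (λ _ → refl) fg (λ _ → refl)
      where
      from : ∀ {t : Pair} → Factors n t × C t → suc (pred (proj₁ t)) ∣ n × C (cofactor (pred (proj₁ t)))
      from {suc d , e} (factors _ eq , c) =
        divides e (trans (sym eq) (*-comm (suc d) e)) , subst (λ k → C (suc d , k)) (cofactor-unique d eq) c
      fg : ∀ {t : Pair} → Factors n t × C t → cofactor (pred (proj₁ t)) ≡ t
      fg {suc d , e} (factors _ eq , _) = cong (suc d ,_) (sym (cofactor-unique d eq))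

    -- Divisors and cofactors of an odd number are odd, so the restriction to odd ones loses no
    -- term.
    σ-divisorSum : ∀ s → parity n ≡ 1ℙ → σ s n ≡ divisorSum 1ℙ 1ℙ (_^ s) n
    σ-divisorSum s n-odd = begin
      ∑ divisors (λ e → suc e ^ s)
        ≡⟨ ∑-≡ divisors (divisors ∩ (hasParities? 1ℙ 1ℙ ∘ cofactor))
             (λ {e} d → d , odd-* (suc e) (n / suc e) (trans (cong parity (Factors.eq (cofactor-Factors d))) n-odd))
             proj₁ (λ _ → refl) ⟩
      ∑ (divisors ∩ (hasParities? 1ℙ 1ℙ ∘ cofactor)) (λ e → suc e ^ s)
        ≡⟨ ∑-divisors (hasParities? 1ℙ 1ℙ) (_^ s) ⟩
      divisorSum 1ℙ 1ℙ (_^ s) n ∎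
      where
      open ≡-Reasoning
      odd-* : ∀ a b → parity (a * b) ≡ 1ℙ → parity a ≡ 1ℙ × parity b ≡ 1ℙ
      odd-* a b p with parity a | parity b | trans (sym (*-homo-* a b)) p
      ... | 1ℙ | 1ℙ | _ = refl , refl

  open import Data.Integer as ℤ using (+_; -1ℤ; 1ℤ)
  import Data.Integer.Properties as ℤ
  import Data.Integer.Tactic.RingSolver as ℤ-Solver
  open import Algebra.Bundles using (AbelianGroup)
  open import Algebra.Properties.Group using (∙-cancelʳ)

  -1^even : ∀ k → parity k ≡ 0ℙ → -1ℤ ℤ.^ k ≡ 1ℤ
  -1^even zero          _ = refl
  -1^even (suc (suc k)) p rewrite -1^even k p = refl

  -1^odd : ∀ k → parity k ≡ 1ℙ → -1ℤ ℤ.^ k ≡ -1ℤ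
  -1^odd 1             _ = refl
  -1^odd (suc (suc k)) p rewrite -1^odd k p = refl

  -- The terms of negative sign are moved across, so that apart from the signed sum only sums in ℕ
  -- occur.
  alternatingSum : ∀ (k w : ℕ → ℕ) xs →
    sumℤ (map (λ e → (-1ℤ ℤ.^ k e) ℤ.* (+ w e)) xs) ℤ.+ + sum (map w (filter (λ e → parity (k e) ℙ.≟ 1ℙ) xs)) ≡
    + sum (map w (filter (λ e → parity (k e) ℙ.≟ 0ℙ) xs))
  alternatingSum k w [] = refl
  alternatingSum k w (x ∷ xs) with parity (k x) in eq
  ... | 0ℙ = begin
    (-1ℤ ℤ.^ k x) ℤ.* + w x ℤ.+ s ℤ.+ v    ≡⟨ cong (λ z → z ℤ.* + w x ℤ.+ s ℤ.+ v) (-1^even (k x) eq) ⟩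
    1ℤ ℤ.* + w x ℤ.+ s ℤ.+ v               ≡⟨ lem (+ w x) s v ⟩
    + w x ℤ.+ (s ℤ.+ v)                    ≡⟨ cong (λ z → + w x ℤ.+ z) (alternatingSum k w xs) ⟩
    + w x ℤ.+ + sum (map w (filter (λ e → parity (k e) ℙ.≟ 0ℙ) xs)) ∎
    where
    open ≡-Reasoning
    s = sumℤ (map (λ e → (-1ℤ ℤ.^ k e) ℤ.* (+ w e)) xs)
    v = + sum (map w (filter (λ e → parity (k e) ℙ.≟ 1ℙ) xs))
    lem : ∀ w s v → 1ℤ ℤ.* w ℤ.+ s ℤ.+ v ≡ w ℤ.+ (s ℤ.+ v)
    lem = ℤ-Solver.solve-∀
  ... | 1ℙ = begin
    (-1ℤ ℤ.^ k x) ℤ.* + w x ℤ.+ s ℤ.+ (+ w x ℤ.+ v)  ≡⟨ cong (λ z → z ℤ.* + w x ℤ.+ s ℤ.+ (+ w x ℤ.+ v)) (-1^odd (k x) eq) ⟩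
    -1ℤ ℤ.* + w x ℤ.+ s ℤ.+ (+ w x ℤ.+ v)            ≡⟨ lem (+ w x) s v ⟩
    s ℤ.+ v                                          ≡⟨ alternatingSum k w xs ⟩
    + sum (map w (filter (λ e → parity (k e) ℙ.≟ 0ℙ) xs)) ∎
    where
    open ≡-Reasoning
    s = sumℤ (map (λ e → (-1ℤ ℤ.^ k e) ℤ.* (+ w e)) xs)
    v = + sum (map w (filter (λ e → parity (k e) ℙ.≟ 1ℙ) xs))
    lem : ∀ w s v → -1ℤ ℤ.* w ℤ.+ s ℤ.+ (w ℤ.+ v) ≡ s ℤ.+ v
    lem = ℤ-Solver.solve-∀

  module _ (m : ℕ) where

    private
      n = suc m
      F = factorizations n

      quotient-1? : (p : Parity) → Decidable {A = Pair} _
      quotient-1? p (d , e) = parity (e ∸ 1) ℙ.≟ p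

    -- The exponent of the sign is the cofactor minus 1, which flips the parity; cofactors are
    -- positive, so the truncated subtraction is exact.
    ∑-quotient-1 : ∀ p → ∑ (divisors m ∩ (quotient-1? p ∘ cofactor m)) suc ≡ ∑ (F ∩ second? (p ℙ.⁻¹)) proj₁
    ∑-quotient-1 p = trans (∑-divisors m (quotient-1? p) id)
      (∑-≡ (F ∩ quotient-1? p) (F ∩ second? (p ℙ.⁻¹))
        (λ { {_ , suc e} (f , pe) → f , ℙ.⁻¹-injective (trans (suc-homo-⁻¹ e) (trans pe (sym (ℙ.⁻¹-involutive p)))) })
        (λ { {_ , suc e} (f , pe) → f , trans (sym (suc-homo-⁻¹ e)) (trans (cong ℙ._⁻¹ pe) (ℙ.⁻¹-involutive p))
           ; {_ , zero} (factors (_ , ()) _ , _) })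
        (λ _ → refl))

    σ̂⁺-divisorSum : σ̂⁺ n ≡ + (divisorSum 1ℙ 1ℙ id n + divisorSum 1ℙ 0ℙ id n)
    σ̂⁺-divisorSum = ∙-cancelʳ (AbelianGroup.group ℤ.+-0-abelianGroup) (+ v) _ _ (begin
      σ̂⁺ n ℤ.+ + v
        ≡⟨ cong (λ z → σ̂⁺ n ℤ.+ + z) (∑-quotient-1 1ℙ) ⟨
      σ̂⁺ n ℤ.+ + ∑ (divisors m ∩ (quotient-1? 1ℙ ∘ cofactor m)) suc
        ≡⟨ alternatingSum (λ e → n / suc e ∸ 1) suc (divisorPreds n) ⟩
      + ∑ (divisors m ∩ (quotient-1? 0ℙ ∘ cofactor m)) suc
        ≡⟨ cong +_ (∑-quotient-1 0ℙ) ⟩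
      + ∑ (F ∩ second? 1ℙ) proj₁
        ≡⟨ cong +_ (∑-firstOdd n) ⟨
      + (∑ (F ∩ first? 1ℙ) proj₁ + v)
        ≡⟨ cong (λ z → + (z + v)) (∑-firstOdd-divisorSum n) ⟩
      + (divisorSum 1ℙ 1ℙ id n + divisorSum 1ℙ 0ℙ id n + v)
        ≡⟨ ℤ.pos-+ (divisorSum 1ℙ 1ℙ id n + divisorSum 1ℙ 0ℙ id n) v ⟩
      + (divisorSum 1ℙ 1ℙ id n + divisorSum 1ℙ 0ℙ id n) ℤ.+ + v ∎)
      where
      open ≡-Reasoning
      v : ℕ
      v = ∑ (F ∩ second? 0ℙ) proj₁

open ℕ-Identities

-- Passage to the rationals

open import Data.Integer as ℤ using (+_)
import Data.Integer.Properties as ℤ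
open import Data.Rational as ℚ using (ℚ; _*_; 1ℚ; toℚᵘ)
import Data.Rational.Properties as ℚ
open import Data.Rational.Unnormalised as ℚᵘ using (mkℚᵘ; *≡*)
import Data.Rational.Unnormalised.Properties as ℚᵘ
open import Data.Rational.Solver using (module +-*-Solver)

fromℕ : ℕ → ℚ
fromℕ n = fromℤ (+ n)

toℚᵘ-fromℕ : ∀ n → toℚᵘ (fromℕ n) ℚᵘ.≃ mkℚᵘ (+ n) 0
toℚᵘ-fromℕ n = ℚ.toℚᵘ-fromℚᵘ (mkℚᵘ (+ n) 0)

-- The comparison is made on unnormalised fractions of denominator 1, where no reduction to lowest
-- terms intervenes.
fromℕ-+ : ∀ m n → fromℕ (m ℕ.+ n) ≡ fromℕ m ℚ.+ fromℕ n
fromℕ-+ m n = ℚ.toℚᵘ-injective (begin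
  toℚᵘ (fromℕ (m ℕ.+ n))                  ≈⟨ toℚᵘ-fromℕ (m ℕ.+ n) ⟩
  mkℚᵘ (+ (m ℕ.+ n)) 0                    ≈⟨ *≡* (cong (ℤ._* + 1) (trans (ℤ.pos-+ m n)
                                               (sym (cong₂ ℤ._+_ (ℤ.*-identityʳ (+ m)) (ℤ.*-identityʳ (+ n)))))) ⟩
  mkℚᵘ (+ m) 0 ℚᵘ.+ mkℚᵘ (+ n) 0          ≈⟨ ℚᵘ.+-cong (toℚᵘ-fromℕ m) (toℚᵘ-fromℕ n) ⟨
  toℚᵘ (fromℕ m) ℚᵘ.+ toℚᵘ (fromℕ n)      ≈⟨ ℚ.toℚᵘ-homo-+ (fromℕ m) (fromℕ n) ⟨
  toℚᵘ (fromℕ m ℚ.+ fromℕ n)              ∎)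
  where open ℚᵘ.≃-Reasoning

fromℕ-* : ∀ m n → fromℕ (m ℕ.* n) ≡ fromℕ m * fromℕ n
fromℕ-* m n = ℚ.toℚᵘ-injective (begin
  toℚᵘ (fromℕ (m ℕ.* n))                  ≈⟨ toℚᵘ-fromℕ (m ℕ.* n) ⟩
  mkℚᵘ (+ (m ℕ.* n)) 0                    ≈⟨ *≡* (cong (ℤ._* + 1) (ℤ.pos-* m n)) ⟩
  mkℚᵘ (+ m) 0 ℚᵘ.* mkℚᵘ (+ n) 0          ≈⟨ ℚᵘ.*-cong (toℚᵘ-fromℕ m) (toℚᵘ-fromℕ n) ⟨
  toℚᵘ (fromℕ m) ℚᵘ.* toℚᵘ (fromℕ n)      ≈⟨ ℚ.toℚᵘ-homo-* (fromℕ m) (fromℕ n) ⟨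
  toℚᵘ (fromℕ m * fromℕ n)                ∎)
  where open ℚᵘ.≃-Reasoning

sumℚ-fromℕ : {A : Set} (c : ℚ) (u : A → ℚ) (w : A → ℕ) → (∀ a → u a ≡ fromℕ (w a) * c) →
             ∀ xs → sumℚ (map u xs) ≡ fromℕ (sum (map w xs)) * c
sumℚ-fromℕ c u w u≡ []       = sym (ℚ.*-zeroˡ c)
sumℚ-fromℕ c u w u≡ (x ∷ xs) = begin
  u x ℚ.+ sumℚ (map u xs)                            ≡⟨ cong₂ ℚ._+_ (u≡ x) (sumℚ-fromℕ c u w u≡ xs) ⟩
  fromℕ (w x) * c ℚ.+ fromℕ (sum (map w xs)) * c     ≡⟨ ℚ.*-distribʳ-+ c (fromℕ (w x)) _ ⟨
  (fromℕ (w x) ℚ.+ fromℕ (sum (map w xs))) * c       ≡⟨ cong (_* c) (fromℕ-+ (w x) _) ⟨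
  fromℕ (w x ℕ.+ sum (map w xs)) * c                 ∎
  where open ≡-Reasoning

1/24 : ℚ
1/24 = + 1 ℚ./ 24

σ̂≡scaledσ̂/24 : ∀ i → σ̂ i ≡ fromℕ (scaledσ̂ i) * 1/24
-- No two positive factors have product 0, so both divisor sums vanish and `scaledσ̂ 0` is 1.
σ̂≡scaledσ̂/24 zero = sym (cong (λ k → fromℕ k * 1/24)
  (cong₂ (λ k l → 24 ℕ.* k ℕ.+ (1 ℕ.+ 24 ℕ.* l)) (divisorSum-0 1ℙ 1ℙ) (divisorSum-0 1ℙ 0ℙ)))
  where
  divisorSum-0 : ∀ p q → divisorSum p q id 0 ≡ 0
  divisorSum-0 p q = ∑-zero (factorizations 0 ∩ hasParities? p q)
    (λ { {suc d , zero} (factors (_ , ()) _ , _) })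
σ̂≡scaledσ̂/24 (suc m) = begin
  fromℤ (σ̂⁺ (suc m))                            ≡⟨ cong fromℤ (σ̂⁺-divisorSum m) ⟩
  fromℕ (o ℕ.+ e)                               ≡⟨ ℚ.*-identityʳ (fromℕ (o ℕ.+ e)) ⟨
  fromℕ (o ℕ.+ e) * (fromℕ 24 * 1/24)           ≡⟨ ℚ.*-assoc (fromℕ (o ℕ.+ e)) (fromℕ 24) 1/24 ⟨
  fromℕ (o ℕ.+ e) * fromℕ 24 * 1/24             ≡⟨ cong (_* 1/24) (fromℕ-* (o ℕ.+ e) 24) ⟨
  fromℕ ((o ℕ.+ e) ℕ.* 24) * 1/24               ≡⟨ cong (λ k → fromℕ k * 1/24)
                                                     (trans (ℕ.*-comm (o ℕ.+ e) 24) (ℕ.*-distribˡ-+ 24 o e)) ⟩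
  fromℕ (24 ℕ.* o ℕ.+ 24 ℕ.* e) * 1/24          ∎
  where
  open ≡-Reasoning
  o e : ℕ
  o = divisorSum 1ℙ 1ℙ id (suc m)
  e = divisorSum 1ℙ 0ℙ id (suc m)

interchange : ∀ a b c d → (a * c) * (b * d) ≡ (a * b) * (c * d)
interchange = solve 4 (λ a b c d → (a :* c) :* (b :* d) := (a :* b) :* (c :* d)) refl
  where open +-*-Solver

product₂ : ∀ i j → σ̂ i * σ̂ j ≡ fromℕ (scaledσ̂ i ℕ.* scaledσ̂ j) * (1/24 * 1/24)
product₂ i j = begin
  σ̂ i * σ̂ j                                              ≡⟨ cong₂ _*_ (σ̂≡scaledσ̂/24 i) (σ̂≡scaledσ̂/24 j) ⟩
  (fromℕ (scaledσ̂ i) * 1/24) * (fromℕ (scaledσ̂ j) * 1/24) ≡⟨ interchange (fromℕ (scaledσ̂ i)) (fromℕ (scaledσ̂ j)) 1/24 1/24 ⟩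
  (fromℕ (scaledσ̂ i) * fromℕ (scaledσ̂ j)) * (1/24 * 1/24) ≡⟨ cong (_* (1/24 * 1/24)) (fromℕ-* (scaledσ̂ i) (scaledσ̂ j)) ⟨
  fromℕ (scaledσ̂ i ℕ.* scaledσ̂ j) * (1/24 * 1/24)         ∎
  where open ≡-Reasoning

product₃ : ∀ i j k → σ̂ i * σ̂ j * σ̂ k ≡ fromℕ (scaledσ̂ i ℕ.* scaledσ̂ j ℕ.* scaledσ̂ k) * (1/24 * 1/24 * 1/24)
product₃ i j k = begin
  σ̂ i * σ̂ j * σ̂ k                                       ≡⟨ cong₂ _*_ (product₂ i j) (σ̂≡scaledσ̂/24 k) ⟩
  (fromℕ ij * (1/24 * 1/24)) * (fromℕ (scaledσ̂ k) * 1/24) ≡⟨ interchange (fromℕ ij) (fromℕ (scaledσ̂ k)) (1/24 * 1/24) 1/24 ⟩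
  (fromℕ ij * fromℕ (scaledσ̂ k)) * (1/24 * 1/24 * 1/24)   ≡⟨ cong (_* (1/24 * 1/24 * 1/24)) (fromℕ-* ij (scaledσ̂ k)) ⟨
  fromℕ (ij ℕ.* scaledσ̂ k) * (1/24 * 1/24 * 1/24)         ∎
  where
  open ≡-Reasoning
  ij = scaledσ̂ i ℕ.* scaledσ̂ j

rescale : ∀ p k d c → p * fromℕ k * c ≡ 1ℚ → fromℕ d ≡ p * (fromℕ (k ℕ.* d) * c)
rescale p k d c eq = begin
  fromℕ d                            ≡⟨ ℚ.*-identityˡ (fromℕ d) ⟨
  1ℚ * fromℕ d                       ≡⟨ cong (_* fromℕ d) eq ⟨
  p * fromℕ k * c * fromℕ d          ≡⟨ solve 4 (λ p k c d → p :* k :* c :* d := p :* (k :* d :* c)) refl p (fromℕ k) c (fromℕ d) ⟩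
  p * (fromℕ k * fromℕ d * c)        ≡⟨ cong (λ z → p * (z * c)) (fromℕ-* k d) ⟨
  p * (fromℕ (k ℕ.* d) * c)          ∎
  where
  open ≡-Reasoning
  open +-*-Solver

corollary3p4 : ∀ (n : ℕ) → 0 < n → ¬ (2 ∣ n) →
    (fromℤ (+ σ 3 n) ≡ fromℤ (+ 12) * sumℚ (map (λ (i , j) → σ̂ i * σ̂ j) (pairs n)))
    × (fromℤ (+ σ 5 n) ≡ fromℤ (+ 192) * sumℚ (map (λ (i , j , k) → σ̂ i * σ̂ j * σ̂ k) (triples n)))
corollary3p4 n@(suc m) _ ¬2∣n = cubes , fifthPowers
  where
  open ≡-Reasoning
  n-odd = ¬2∣⇒odd n ¬2∣n
  δ₃ δ₅ : ℕ
  δ₃ = divisorSum 1ℙ 1ℙ (_^ 3) n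
  δ₅ = divisorSum 1ℙ 1ℙ (_^ 5) n

  cubes : fromℤ (+ σ 3 n) ≡ fromℤ (+ 12) * sumℚ (map (λ (i , j) → σ̂ i * σ̂ j) (pairs n))
  cubes = begin
    fromℕ (σ 3 n)                                    ≡⟨ cong fromℕ (σ-divisorSum m 3 n-odd) ⟩
    -- The numerical condition is 12 · 48 / 24² = 1.
    fromℕ δ₃                                         ≡⟨ rescale (fromℕ 12) 48 δ₃ (1/24 * 1/24) refl ⟩
    fromℕ 12 * (fromℕ (48 ℕ.* δ₃) * (1/24 * 1/24))   ≡⟨ cong (λ k → fromℕ 12 * (fromℕ k * (1/24 * 1/24)))
      (trans (sym (scaledσ̂⋆² n n-odd)) (∑-antidiagonal n (λ (i , j) → scaledσ̂ i ℕ.* scaledσ̂ j))) ⟩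
    fromℕ 12 * (fromℕ (sum (map (λ (i , j) → scaledσ̂ i ℕ.* scaledσ̂ j) (pairs n))) * (1/24 * 1/24))
      ≡⟨ cong (fromℕ 12 *_) (sumℚ-fromℕ (1/24 * 1/24) _ _ (λ (i , j) → product₂ i j) (pairs n)) ⟨
    fromℕ 12 * sumℚ (map (λ (i , j) → σ̂ i * σ̂ j) (pairs n)) ∎

  fifthPowers : fromℤ (+ σ 5 n) ≡ fromℤ (+ 192) * sumℚ (map (λ (i , j , k) → σ̂ i * σ̂ j * σ̂ k) (triples n))
  fifthPowers = begin
    fromℕ (σ 5 n)                                            ≡⟨ cong fromℕ (σ-divisorSum m 5 n-odd) ⟩
    -- The numerical condition is 192 · 72 / 24³ = 1.
    fromℕ δ₅                                                 ≡⟨ rescale (fromℕ 192) 72 δ₅ (1/24 * 1/24 * 1/24) refl ⟩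
    fromℕ 192 * (fromℕ (72 ℕ.* δ₅) * (1/24 * 1/24 * 1/24))   ≡⟨ cong (λ k → fromℕ 192 * (fromℕ k * (1/24 * 1/24 * 1/24)))
      (trans (sym (scaledσ̂⋆³ n n-odd)) (trans (sym (triple⋆ scaledσ̂ scaledσ̂ scaledσ̂ n))
        (∑-antidiagonal₃ n (λ (i , j , k) → scaledσ̂ i ℕ.* scaledσ̂ j ℕ.* scaledσ̂ k)))) ⟩
    fromℕ 192 * (fromℕ (sum (map (λ (i , j , k) → scaledσ̂ i ℕ.* scaledσ̂ j ℕ.* scaledσ̂ k) (triples n))) * (1/24 * 1/24 * 1/24))
      ≡⟨ cong (fromℕ 192 *_) (sumℚ-fromℕ (1/24 * 1/24 * 1/24) _ _ (λ (i , j , k) → product₃ i j k) (triples n)) ⟨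
    fromℕ 192 * sumℚ (map (λ (i , j , k) → σ̂ i * σ̂ j * σ̂ k) (triples n)) ∎
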